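{- For any triangle-free strongly regular graph $G$, $\beta(G)\leq\frac1{50}$.
   Context: All graphs are finite and simple. A regular triangle-free graph $G$ is called strongly regular if $|N_G(v)\cap N_G(w)|$ takes the same value $c$ for all pairs $(v,w)$ of distinct non-adjacent vertices, where $N_G(v)$ is the set of neighbours of $v$. For a graph $G$ with $n\geq 1$ vertices, a half in $G$ is a function $\mu: V(G)\to[0,1]$ such that $\sum_{v\in V(G)}\mu(v)=n/2$. Put $\beta(G,\mu)=\frac1{n^2}\sum_{\{u,v\}\in E(G)}\mu(u)\mu(v)$ (each edge is counted once) and $\beta(G)=\min\{\beta(G,\mu): \mu \text{ is a half in } G\}$. -}

module Defs where

open import Level using (0ℓ)
open import Algebra.Bundles.Raw using (RawMonoid)
import Algebra.Definitions.RawMonoid as RawMonoidDefinitions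
open import Data.Bool using (Bool; true; false; _∧_; if_then_else_)
open import Data.Fin using (Fin; _<?_)
open import Data.Fin.Subset using (Subset; _∩_; ∣_∣)
open import Data.Integer using (+_)
open import Data.Nat as ℕ using (ℕ; NonZero; _⊔_)
import Data.Nat.Properties as ℕ
open import Data.Product using (_×_; _,_; ∃-syntax)
open import Data.Rational as ℚ using (ℚ; 0ℚ; 1ℚ; ½; 1/_; Positive; NonNegative)
import Data.Rational.Properties as ℚ
open import Data.Rational.Solver using (module +-*-Solver)
open import Data.Vec using (tabulate)
open import Relation.Binary.PropositionalEquality
open import Relation.Nullary using (¬_; does)

------------------------------------------------------------------------
-- Real numbers: Cauchy sequences of rationals, considered up to _≈_.

IsCauchy : (ℕ → ℚ) → Set
IsCauchy x = ∀ ε → .{{Positive ε}} →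
  ∃[ N ] (∀ i j → N ℕ.≤ i → N ℕ.≤ j → ℚ.∣ x i ℚ.- x j ∣ ℚ.≤ ε)

record ℝ : Set where
  constructor mkℝ
  field
    seq    : ℕ → ℚ
    cauchy : IsCauchy seq

open ℝ public

-- x ≤ y compares the limits, so finitely many terms are irrelevant and
-- an arbitrarily small slack is allowed.

infix 4 _≤_ _≈_

_≤_ : ℝ → ℝ → Set
x ≤ y = ∀ ε → .{{Positive ε}} →
  ∃[ N ] (∀ i → N ℕ.≤ i → seq x i ℚ.≤ seq y i ℚ.+ ε)

_≈_ : ℝ → ℝ → Set
x ≈ y = x ≤ y × y ≤ x

private
  open +-*-Solver using (solve; _:=_; _:+_; _:*_; _:-_)
  open ℚ.≤-Reasoning

  -‿+-interchange : ∀ a b c d →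
    (a ℚ.+ b) ℚ.- (c ℚ.+ d) ≡ (a ℚ.- c) ℚ.+ (b ℚ.- d)
  -‿+-interchange = solve 4 (λ a b c d →
    (a :+ b) :- (c :+ d) := (a :- c) :+ (b :- d)) refl

  *-difference : ∀ a b c d →
    a ℚ.* b ℚ.- c ℚ.* d ≡ a ℚ.* (b ℚ.- d) ℚ.+ d ℚ.* (a ℚ.- c)
  *-difference = solve 4 (λ a b c d →
    a :* b :- c :* d := a :* (b :- d) :+ d :* (a :- c)) refl

  a≡a-b+b : ∀ a b → a ≡ (a ℚ.- b) ℚ.+ b
  a≡a-b+b = solve 2 (λ a b → a := (a :- b) :+ b) refl

  *-swap : ∀ a b c → a ℚ.* (b ℚ.* c) ≡ b ℚ.* (a ℚ.* c)
  *-swap = solve 3 (λ a b c → a :* (b :* c) := b :* (a :* c)) refl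

  +-close : ∀ a b c d {δ} →
    ℚ.∣ a ℚ.- c ∣ ℚ.≤ δ → ℚ.∣ b ℚ.- d ∣ ℚ.≤ δ →
    ℚ.∣ (a ℚ.+ b) ℚ.- (c ℚ.+ d) ∣ ℚ.≤ δ ℚ.+ δ
  +-close a b c d {δ} ac bd = begin
    ℚ.∣ (a ℚ.+ b) ℚ.- (c ℚ.+ d) ∣      ≡⟨ cong ℚ.∣_∣ (-‿+-interchange a b c d) ⟩
    ℚ.∣ (a ℚ.- c) ℚ.+ (b ℚ.- d) ∣      ≤⟨ ℚ.∣p+q∣≤∣p∣+∣q∣ (a ℚ.- c) (b ℚ.- d) ⟩
    ℚ.∣ a ℚ.- c ∣ ℚ.+ ℚ.∣ b ℚ.- d ∣    ≤⟨ ℚ.+-mono-≤ ac bd ⟩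
    δ ℚ.+ δ                            ∎

  *-bound : ∀ p q {r δ} .{{_ : NonNegative δ}} →
    ℚ.∣ p ∣ ℚ.≤ r → ℚ.∣ q ∣ ℚ.≤ δ → ℚ.∣ p ℚ.* q ∣ ℚ.≤ r ℚ.* δ
  *-bound p q {r} {δ} p≤r q≤δ = begin
    ℚ.∣ p ℚ.* q ∣          ≡⟨ ℚ.∣p*q∣≡∣p∣*∣q∣ p q ⟩
    ℚ.∣ p ∣ ℚ.* ℚ.∣ q ∣    ≤⟨ ℚ.*-monoˡ-≤-nonNeg ℚ.∣ p ∣ {{ℚ.∣-∣-nonNeg p}} q≤δ ⟩
    ℚ.∣ p ∣ ℚ.* δ          ≤⟨ ℚ.*-monoʳ-≤-nonNeg δ p≤r ⟩
    r ℚ.* δ                ∎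

  *-close : ∀ a b c d {B C δ} .{{_ : NonNegative δ}} →
    ℚ.∣ a ∣ ℚ.≤ B → ℚ.∣ d ∣ ℚ.≤ C →
    ℚ.∣ a ℚ.- c ∣ ℚ.≤ δ → ℚ.∣ b ℚ.- d ∣ ℚ.≤ δ →
    ℚ.∣ a ℚ.* b ℚ.- c ℚ.* d ∣ ℚ.≤ (B ℚ.+ C) ℚ.* δ
  *-close a b c d {B} {C} {δ} aB dC ac bd = begin
    ℚ.∣ a ℚ.* b ℚ.- c ℚ.* d ∣
      ≡⟨ cong ℚ.∣_∣ (*-difference a b c d) ⟩
    ℚ.∣ a ℚ.* (b ℚ.- d) ℚ.+ d ℚ.* (a ℚ.- c) ∣
      ≤⟨ ℚ.∣p+q∣≤∣p∣+∣q∣ (a ℚ.* (b ℚ.- d)) (d ℚ.* (a ℚ.- c)) ⟩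
    ℚ.∣ a ℚ.* (b ℚ.- d) ∣ ℚ.+ ℚ.∣ d ℚ.* (a ℚ.- c) ∣
      ≤⟨ ℚ.+-mono-≤ (*-bound a (b ℚ.- d) aB bd) (*-bound d (a ℚ.- c) dC ac) ⟩
    B ℚ.* δ ℚ.+ C ℚ.* δ
      ≡⟨ ℚ.*-distribʳ-+ δ B C ⟨
    (B ℚ.+ C) ℚ.* δ ∎

  half+half : ∀ ε → ½ ℚ.* ε ℚ.+ ½ ℚ.* ε ≡ ε
  half+half ε = trans (sym (ℚ.*-distribʳ-+ ε ½ ½)) (ℚ.*-identityˡ ε)

  D*[ε/D] : ∀ D ε .{{_ : ℚ.NonZero D}} → D ℚ.* (ε ℚ.* 1/ D) ≡ ε
  D*[ε/D] D ε = trans (*-swap D ε (1/ D))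
    (trans (cong (ε ℚ.*_) (ℚ.*-inverseʳ D)) (ℚ.*-identityʳ ε))

const-cauchy : ∀ q → IsCauchy (λ _ → q)
const-cauchy q ε = 0 , λ _ _ _ _ → begin
  ℚ.∣ q ℚ.- q ∣  ≡⟨ cong ℚ.∣_∣ (ℚ.+-inverseʳ q) ⟩
  0ℚ             ≤⟨ ℚ.<⇒≤ (ℚ.positive⁻¹ ε) ⟩
  ε              ∎

+-cauchy : ∀ x y → IsCauchy x → IsCauchy y → IsCauchy (λ i → x i ℚ.+ y i)
+-cauchy x y cx cy ε =
  let instance _ = ℚ.pos*pos⇒pos ½ ε
      M , xM = cx (½ ℚ.* ε)
      N , yN = cy (½ ℚ.* ε)
  in M ⊔ N , λ i j hi hj →
    ℚ.≤-trans
      (+-close (x i) (y i) (x j) (y j)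
        (xM i j (ℕ.m⊔n≤o⇒m≤o M N hi) (ℕ.m⊔n≤o⇒m≤o M N hj))
        (yN i j (ℕ.m⊔n≤o⇒n≤o M N hi) (ℕ.m⊔n≤o⇒n≤o M N hj)))
      (ℚ.≤-reflexive (half+half ε))

eventually-bounded : ∀ x → IsCauchy x →
  ∃[ B ] Positive B × ∃[ N ] (∀ i → N ℕ.≤ i → ℚ.∣ x i ∣ ℚ.≤ B)
eventually-bounded x cx =
  let N , xN = cx 1ℚ in
  1ℚ ℚ.+ ℚ.∣ x N ∣ ,
  ℚ.pos+nonNeg⇒pos 1ℚ ℚ.∣ x N ∣ {{ℚ.∣-∣-nonNeg (x N)}} ,
  N , λ i Ni → begin
    ℚ.∣ x i ∣                        ≡⟨ cong ℚ.∣_∣ (a≡a-b+b (x i) (x N)) ⟩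
    ℚ.∣ (x i ℚ.- x N) ℚ.+ x N ∣      ≤⟨ ℚ.∣p+q∣≤∣p∣+∣q∣ (x i ℚ.- x N) (x N) ⟩
    ℚ.∣ x i ℚ.- x N ∣ ℚ.+ ℚ.∣ x N ∣  ≤⟨ ℚ.+-monoˡ-≤ ℚ.∣ x N ∣ (xN i N Ni ℕ.≤-refl) ⟩
    1ℚ ℚ.+ ℚ.∣ x N ∣                 ∎

*-cauchy : ∀ x y → IsCauchy x → IsCauchy y → IsCauchy (λ i → x i ℚ.* y i)
*-cauchy x y cx cy ε =
  let B , B>0 , K , xB = eventually-bounded x cx
      C , C>0 , L , yC = eventually-bounded y cy
      D    = B ℚ.+ C
      D>0  = ℚ.pos+pos⇒pos B {{B>0}} C {{C>0}}
      instance D≢0 = ℚ.pos⇒nonZero D {{D>0}}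
      δ    = ε ℚ.* 1/ D
      δ>0  = ℚ.pos*pos⇒pos ε (1/ D) {{ℚ.1/pos⇒pos D {{D>0}}}}
      M , xM = cx δ {{δ>0}}
      N , yN = cy δ {{δ>0}}
      R    = (K ⊔ L) ⊔ (M ⊔ N)
      KL≤ : ∀ {i} → R ℕ.≤ i → K ⊔ L ℕ.≤ i
      KL≤ = ℕ.m⊔n≤o⇒m≤o (K ⊔ L) (M ⊔ N)
      MN≤ : ∀ {i} → R ℕ.≤ i → M ⊔ N ℕ.≤ i
      MN≤ = ℕ.m⊔n≤o⇒n≤o (K ⊔ L) (M ⊔ N)
  in R , λ i j hi hj →
    ℚ.≤-trans
      (*-close (x i) (y i) (x j) (y j) {{ℚ.pos⇒nonNeg δ {{δ>0}}}}
        (xB i (ℕ.m⊔n≤o⇒m≤o K L (KL≤ hi)))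
        (yC j (ℕ.m⊔n≤o⇒n≤o K L (KL≤ hj)))
        (xM i j (ℕ.m⊔n≤o⇒m≤o M N (MN≤ hi)) (ℕ.m⊔n≤o⇒m≤o M N (MN≤ hj)))
        (yN i j (ℕ.m⊔n≤o⇒n≤o M N (MN≤ hi)) (ℕ.m⊔n≤o⇒n≤o M N (MN≤ hj))))
      (ℚ.≤-reflexive (D*[ε/D] D ε))

fromℚ : ℚ → ℝ
fromℚ q = mkℝ (λ _ → q) (const-cauchy q)

0ℝ 1ℝ : ℝ
0ℝ = fromℚ 0ℚ
1ℝ = fromℚ 1ℚ

infixl 6 _+_
infixl 7 _*_

_+_ : ℝ → ℝ → ℝ
x + y = mkℝ (λ i → seq x i ℚ.+ seq y i) (+-cauchy (seq x) (seq y) (cauchy x) (cauchy y))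

_*_ : ℝ → ℝ → ℝ
x * y = mkℝ (λ i → seq x i ℚ.* seq y i) (*-cauchy (seq x) (seq y) (cauchy x) (cauchy y))

+-rawMonoid : RawMonoid 0ℓ 0ℓ
+-rawMonoid = record { Carrier = ℝ ; _≈_ = _≈_ ; _∙_ = _+_ ; ε = 0ℝ }

open RawMonoidDefinitions +-rawMonoid public using (sum)

------------------------------------------------------------------------
-- Finite simple graphs, with vertex set Fin n.

record Graph (n : ℕ) : Set where
  field
    adj         : Fin n → Fin n → Bool
    symmetric   : ∀ u v → adj u v ≡ adj v u
    irreflexive : ∀ v → adj v v ≡ false

  neighbours : Fin n → Subset n
  neighbours v = tabulate (adj v)

open Graph public

module _ {n : ℕ} (G : Graph n) where

  Regular : Set
  Regular = ∃[ k ] ∀ v → ∣ neighbours G v ∣ ≡ k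

  TriangleFree : Set
  TriangleFree = ∀ u v w →
    ¬ (adj G u v ≡ true × adj G v w ≡ true × adj G u w ≡ true)

  TriangleFreeStronglyRegular : Set
  TriangleFreeStronglyRegular =
    Regular ×
    TriangleFree ×
    ∃[ c ] (∀ v w → v ≢ w → adj G v w ≡ false →
              ∣ neighbours G v ∩ neighbours G w ∣ ≡ c)

------------------------------------------------------------------------
-- Halves and sparsity.

IsHalf : ∀ {n} → (Fin n → ℝ) → Set
IsHalf {n} μ =
  (∀ v → 0ℝ ≤ μ v × μ v ≤ 1ℝ) ×
  sum μ ≈ fromℚ (+ n ℚ./ 2)

-- Restricting to u < v counts each edge {u , v} once.

edgeWeight : ∀ {n} → Graph n → (Fin n → ℝ) → ℝ
edgeWeight G μ =
  sum λ u → sum λ v →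
    if adj G u v ∧ does (u <? v) then μ u * μ v else 0ℝ

density : ∀ {n} → .{{NonZero n}} → Graph n → (Fin n → ℝ) → ℝ
density {n} G μ = fromℚ (ℚ._/_ (+ 1) (n ℕ.* n) {{ℕ.m*n≢0 n n}}) * edgeWeight G μ

-- A minimum, as a least element that is attained, is unique up to _≈_.
-- It is a relation because constructively its existence needs proof.

IsMinimum : (ℝ → Set) → ℝ → Set
IsMinimum P b = P b × (∀ x → P x → b ≤ x)

_Isβ_ : ∀ {n} → .{{NonZero n}} → ℝ → Graph n → Set
b Isβ G = IsMinimum (λ x → ∃[ μ ] (IsHalf μ × density G μ ≈ x)) b

{-# OPTIONS --safe #-}
module Submission where

-- The edge weight of a half is concave along e_u − e_v, so mass can be moved
-- between any two vertices until at most one weight differs from 0 and 1.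
-- Hence β(G) is a minimum over finitely many rational halves, and a single
-- half of density at most 1/50 suffices.
--
-- Let k be the degree.  If 25k ≤ 4n the constant half works, if n ≤ 2k a
-- multiple of a neighbourhood, and if k = 1 the weight 1 on one end of an edge,
-- 0 on the other and ½ elsewhere.  Otherwise take a path u, v, w.  Since
-- A² = (k − c)I + c(J − A), all edge counts between {u}, {v}, {w}, N(u) ∖ N(w)
-- and the complement R of N(u) ∪ N(v) ∪ N(w) depend on n, k, c only, and
-- so does the density of a half that is constant on these sets and zero
-- elsewhere.  The Krein inequality, a second moment estimate for common
-- neighbours with u and w, leaves finitely many (n, k, c), and for each of
-- them one of four choices of the weights is good enough.

-- A term of a Cauchy sequence satisfies the conditions on a half only approximately, and
-- inequalities of reals cannot be decided. The lower bound for β is therefore proved index by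
-- index: each rational approximant is corrected to an exact rational half at a cost proportional to
-- its error, and only this half is rounded and compared with the finite list.
--
-- The threshold 25k ≤ 4n is where the constant half, of density k/(8n), is good enough. Beyond it,
-- k² = (k - c) + c(n - k) yields 4k ≤ 21c + 3, while 2k < n yields c < k. Substituted into the
-- Krein expression, the same equation cancels the terms c²k², and the part of degree four is -c³(k
-- - c). In the range c < k ≤ (21c + 3)/4 the remaining terms, of degree three and less, cannot
-- compensate it once c ≥ 16. This is what makes the list of parameters finite.
--
-- The sets attached to the path are chosen for their few edges: N(u) is independent, and a vertex
-- of R has c of its k neighbours in each of the three removed neighbourhoods.

-- Sums and bilinear forms over a commutative ring.

module LinearAlgebra where

  open import Level using (0ℓ)
  open import Algebra.Bundles using (CommutativeRing)
  import Algebra.Properties.Semiring.Sum as SemiringSum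
  open import Data.Bool using (Bool; if_then_else_)
  open import Data.Fin using (Fin; zero; suc; _≟_)
  open import Data.Nat using (ℕ; suc)
  open import Data.Vec.Functional using (Vector)
  open import Relation.Binary.PropositionalEquality as ≡ using (_≡_; _≢_)
  open import Relation.Nullary using (does; yes; no; contradiction)

  module BilinearForm (R : CommutativeRing 0ℓ 0ℓ) where
    open CommutativeRing R hiding (zero)
    open SemiringSum semiring public
    open import Algebra.Properties.CommutativeSemigroup *-commutativeSemigroup using (x∙yz≈y∙xz)
    open import Relation.Binary.Reasoning.Setoid setoid

    private
      variable
        m n : ℕ

    ⟦_⟧ : Bool → Carrier
    ⟦ b ⟧ = if b then 1# else 0#

    -- The standard basis vector at `p`; as a function of both arguments, the identity matrix.
    unit : Fin n → Vector Carrier n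
    unit p v = ⟦ does (p ≟ v) ⟧

    ∑-unit : ∀ (p : Fin n) f → ∑[ v < n ] (unit p v * f v) ≈ f p
    ∑-unit {suc n} zero f = begin
      1# * f zero + ∑[ v < n ] (0# * f (suc v))  ≈⟨ +-cong (*-identityˡ _) (sum-cong-≋ λ v → zeroˡ (f (suc v))) ⟩
      f zero + ∑[ v < n ] 0#                     ≈⟨ +-congˡ (sum-replicate-zero n) ⟩
      f zero + 0#                                ≈⟨ +-identityʳ _ ⟩
      f zero                                     ∎
    ∑-unit {suc n} (suc p) f = begin
      0# * f zero + ∑[ v < n ] (unit p v * f (suc v))  ≈⟨ +-cong (zeroˡ _) (∑-unit p (λ v → f (suc v))) ⟩
      0# + f (suc p)                                   ≈⟨ +-identityˡ _ ⟩
      f (suc p)                                        ∎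

    unit-same : ∀ (p : Fin n) → unit p p ≡ 1#
    unit-same p with p ≟ p
    ... | yes _  = ≡.refl
    ... | no p≢p = contradiction ≡.refl p≢p

    unit-other : ∀ {p v : Fin n} → p ≢ v → unit p v ≡ 0#
    unit-other {p = p} {v} p≢v with p ≟ v
    ... | yes p≡v = contradiction p≡v p≢v
    ... | no _    = ≡.refl

    sum-unit : ∀ (p : Fin n) → sum (unit p) ≈ 1#
    sum-unit {n} p = begin
      ∑[ v < n ] unit p v         ≈⟨ (sum-cong-≋ λ v → *-identityʳ (unit p v)) ⟨
      ∑[ v < n ] (unit p v * 1#)  ≈⟨ ∑-unit p (λ _ → 1#) ⟩
      1#                          ∎

    ∑-*ˡ : ∀ a (f : Vector Carrier n) → ∑[ v < n ] (a * f v) ≈ a * ∑[ v < n ] f v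
    ∑-*ˡ a f = sym (*-distribˡ-sum a f)

    ∑-*ʳ : ∀ a (f : Vector Carrier n) → ∑[ v < n ] (f v * a) ≈ ∑[ v < n ] f v * a
    ∑-*ʳ a f = sym (*-distribʳ-sum a f)

    form : (Fin n → Fin n → Carrier) → Vector Carrier n → Vector Carrier n → Carrier
    form {n} M x y = ∑[ u < n ] ∑[ v < n ] (M u v * (x u * y v))

    form-cong : ∀ (M : Fin n → Fin n → Carrier) {x x′ y y′} →
      (∀ v → x v ≈ x′ v) → (∀ v → y v ≈ y′ v) → form M x y ≈ form M x′ y′
    form-cong M x≈ y≈ = sum-cong-≋ λ u → sum-cong-≋ λ v → *-congˡ (*-cong (x≈ u) (y≈ v))

    form-unit : ∀ (M : Fin n → Fin n → Carrier) p q → form M (unit p) (unit q) ≈ M p q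
    form-unit {n} M p q = begin
      ∑[ u < n ] ∑[ v < n ] (M u v * (unit p u * unit q v))  ≈⟨ (sum-cong-≋ λ u → sum-cong-≋ λ v → rearrange u v) ⟩
      ∑[ u < n ] ∑[ v < n ] (unit p u * (unit q v * M u v))  ≈⟨ (sum-cong-≋ λ u → ∑-*ˡ (unit p u) (λ v → unit q v * M u v)) ⟩
      ∑[ u < n ] (unit p u * ∑[ v < n ] (unit q v * M u v))  ≈⟨ ∑-unit p (λ u → ∑[ v < n ] (unit q v * M u v)) ⟩
      ∑[ v < n ] (unit q v * M p v)                          ≈⟨ ∑-unit q (M p) ⟩
      M p q                                                  ∎
      where
      rearrange : ∀ u v → M u v * (unit p u * unit q v) ≈ unit p u * (unit q v * M u v)
      rearrange u v = trans (*-comm _ _) (*-assoc _ _ _)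

    combination : Vector Carrier m → (Fin m → Vector Carrier n) → Vector Carrier n
    combination {m} α f v = ∑[ i < m ] (α i * f i v)

    private
      pull : ∀ (g : Fin m → Fin n → Fin n → Carrier) (α : Vector Carrier m) →
        ∑[ u < n ] ∑[ v < n ] ∑[ i < m ] (α i * g i u v) ≈
        ∑[ i < m ] (α i * ∑[ u < n ] ∑[ v < n ] g i u v)
      pull {m} {n} g α = begin
        ∑[ u < n ] ∑[ v < n ] ∑[ i < m ] (α i * g i u v)    ≈⟨ (sum-cong-≋ λ u → ∑-comm (λ v i → α i * g i u v)) ⟩
        ∑[ u < n ] ∑[ i < m ] ∑[ v < n ] (α i * g i u v)    ≈⟨ ∑-comm (λ u i → ∑[ v < n ] (α i * g i u v)) ⟩
        ∑[ i < m ] ∑[ u < n ] ∑[ v < n ] (α i * g i u v)    ≈⟨ (sum-cong-≋ λ i → sum-cong-≋ λ u → ∑-*ˡ (α i) (g i u)) ⟩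
        ∑[ i < m ] ∑[ u < n ] (α i * ∑[ v < n ] g i u v)    ≈⟨ (sum-cong-≋ λ i → ∑-*ˡ (α i) (λ u → ∑[ v < n ] g i u v)) ⟩
        ∑[ i < m ] (α i * ∑[ u < n ] ∑[ v < n ] g i u v)    ∎

    form-combinationˡ : ∀ (M : Fin n → Fin n → Carrier) (α : Vector Carrier m) f y →
      form M (combination α f) y ≈ ∑[ i < m ] (α i * form M (f i) y)
    form-combinationˡ {n} {m} M α f y = trans
      (sum-cong-≋ λ u → sum-cong-≋ λ v → distribute u v)
      (pull (λ i u v → M u v * (f i u * y v)) α)
      where
      distribute : ∀ u v → M u v * (combination α f u * y v) ≈
        ∑[ i < m ] (α i * (M u v * (f i u * y v)))
      distribute u v = begin
        M u v * (∑[ i < m ] (α i * f i u) * y v)    ≈⟨ *-congˡ (∑-*ʳ (y v) (λ i → α i * f i u)) ⟨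
        M u v * ∑[ i < m ] (α i * f i u * y v)      ≈⟨ ∑-*ˡ (M u v) (λ i → α i * f i u * y v) ⟨
        ∑[ i < m ] (M u v * (α i * f i u * y v))    ≈⟨ (sum-cong-≋ λ i → trans (*-congˡ (*-assoc (α i) (f i u) (y v))) (x∙yz≈y∙xz (M u v) (α i) (f i u * y v))) ⟩
        ∑[ i < m ] (α i * (M u v * (f i u * y v)))  ∎

    form-combinationʳ : ∀ (M : Fin n → Fin n → Carrier) x (β : Vector Carrier m) g →
      form M x (combination β g) ≈ ∑[ j < m ] (β j * form M x (g j))
    form-combinationʳ {n} {m} M x β g = trans
      (sum-cong-≋ λ u → sum-cong-≋ λ v → distribute u v)
      (pull (λ j u v → M u v * (x u * g j v)) β)
      where
      distribute : ∀ u v → M u v * (x u * combination β g v) ≈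
        ∑[ j < m ] (β j * (M u v * (x u * g j v)))
      distribute u v = begin
        M u v * (x u * ∑[ j < m ] (β j * g j v))    ≈⟨ *-congˡ (∑-*ˡ (x u) (λ j → β j * g j v)) ⟨
        M u v * ∑[ j < m ] (x u * (β j * g j v))    ≈⟨ ∑-*ˡ (M u v) (λ j → x u * (β j * g j v)) ⟨
        ∑[ j < m ] (M u v * (x u * (β j * g j v)))  ≈⟨ (sum-cong-≋ λ j → trans (*-congˡ (x∙yz≈y∙xz (x u) (β j) (g j v))) (x∙yz≈y∙xz (M u v) (β j) (x u * g j v))) ⟩
        ∑[ j < m ] (β j * (M u v * (x u * g j v)))  ∎

    -- The Gram expansion. Quadratic forms are evaluated below by listing a few vectors with known
    -- pairwise products, so that only a polynomial identity remains.
    form-combination : ∀ (M : Fin n → Fin n → Carrier) (α : Vector Carrier m) f →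
      form M (combination α f) (combination α f) ≈
      ∑[ i < m ] (α i * ∑[ j < m ] (α j * form M (f i) (f j)))
    form-combination M α f = trans
      (form-combinationˡ M α f (combination α f))
      (sum-cong-≋ λ i → *-congˡ (form-combinationʳ M (f i) α f))

    sum-combination : ∀ (α : Vector Carrier m) (f : Fin m → Vector Carrier n) →
      sum (combination α f) ≈ ∑[ i < m ] (α i * sum (f i))
    sum-combination {m} {n} α f = begin
      ∑[ v < n ] ∑[ i < m ] (α i * f i v)  ≈⟨ ∑-comm (λ v i → α i * f i v) ⟩
      ∑[ i < m ] ∑[ v < n ] (α i * f i v)  ≈⟨ (sum-cong-≋ λ i → ∑-*ˡ (α i) (f i)) ⟩
      ∑[ i < m ] (α i * sum (f i))         ∎

-- Rounding rational halves to almost integral ones.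

module RationalRounding where

  open LinearAlgebra
  open import Data.Fin as Fin using (Fin; zero; suc)
  open import Data.Nat as ℕ using (ℕ; zero; suc)
  open import Data.List using (List; []; _∷_; allFin; filter; cartesianProductWith)
  import Data.List.Extrema as Extrema
  open import Relation.Binary.Bundles using (DecTotalOrder)
  open import Data.List.Membership.Propositional using (_∉_)
  open import Data.List.Membership.Propositional.Properties using (∈-allFin; ∈-filter⁺; ∈-cartesianProductWith⁺)
  open import Data.List.Relation.Unary.Any using (here; there)
  import Data.List.Relation.Unary.All as All
  open import Data.List.Relation.Unary.All.Properties using (all-filter)
  open import Data.Product using (_×_; _,_; ∃-syntax; proj₁; proj₂)
  open import Data.Rational as ℚ hiding (NonZero; _/_)
  import Data.Rational.Properties as ℚ
  open import Data.Rational.Solver using (module +-*-Solver)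
  open import Data.Sum using (_⊎_; inj₁; inj₂; swap)
  open import Data.Vec.Functional using (Vector)
  open import Function using (_∘_)
  open import Relation.Binary.PropositionalEquality
  open import Relation.Nullary using (Dec; yes; no; contradiction; _×-dec_)
  import Data.Fin.Properties as Fin

  module ∑ℚ = BilinearForm ℚ.+-*-commutativeRing

  module _ where
    open ℚ.≤-Reasoning

    0≤+ : ∀ {p q} → 0ℚ ≤ p → 0ℚ ≤ q → 0ℚ ≤ p + q
    0≤+ 0≤p 0≤q = ℚ.+-mono-≤ 0≤p 0≤q

    0≤* : ∀ {p q} → 0ℚ ≤ p → 0ℚ ≤ q → 0ℚ ≤ p * q
    0≤* {p} {q} 0≤p 0≤q =
      ℚ.nonNegative⁻¹ (p * q) {{ℚ.nonNeg*nonNeg⇒nonNeg p {{nonNegative 0≤p}} q {{nonNegative 0≤q}}}}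

    p≤p+q : ∀ {p q} → 0ℚ ≤ q → p ≤ p + q
    p≤p+q {p} {q} 0≤q = begin
      p       ≡⟨ ℚ.+-identityʳ p ⟨
      p + 0ℚ  ≤⟨ ℚ.+-monoʳ-≤ p 0≤q ⟩
      p + q   ∎

    p≤q⇒0≤q-p : ∀ {p q} → p ≤ q → 0ℚ ≤ q - p
    p≤q⇒0≤q-p {p} {q} p≤q = begin
      0ℚ     ≡⟨ ℚ.+-inverseʳ p ⟨
      p - p  ≤⟨ ℚ.+-monoˡ-≤ (- p) p≤q ⟩
      q - p  ∎

    ≤-from-gap : ∀ {p q} r → 0ℚ ≤ r → q ≡ p + r → p ≤ q
    ≤-from-gap r 0≤r refl = p≤p+q 0≤r

    ∑ℚ-mono : ∀ {n} {f g : Vector ℚ n} → (∀ v → f v ≤ g v) → ∑ℚ.sum f ≤ ∑ℚ.sum g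
    ∑ℚ-mono {zero}  f≤g = ℚ.≤-refl
    ∑ℚ-mono {suc n} f≤g = ℚ.+-mono-≤ (f≤g zero) (∑ℚ-mono (f≤g ∘ suc))

    ∑ℚ-nonneg : ∀ {n} {f : Vector ℚ n} → (∀ v → 0ℚ ≤ f v) → 0ℚ ≤ ∑ℚ.sum f
    ∑ℚ-nonneg {n} {f} 0≤f = begin
      0ℚ                     ≡⟨ ∑ℚ.sum-replicate-zero n ⟨
      ∑ℚ.sum {n} (λ _ → 0ℚ)  ≤⟨ ∑ℚ-mono 0≤f ⟩
      ∑ℚ.sum f               ∎

  Integral : ℚ → Set
  Integral q = q ≡ 0ℚ ⊎ q ≡ 1ℚ

  InBox : ∀ {n} → Vector ℚ n → Set
  InBox x = ∀ v → 0ℚ ≤ x v × x v ≤ 1ℚ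

  module Rounding {n : ℕ} (w : Fin n → Fin n → ℚ)
    (w≥0 : ∀ u v → 0ℚ ≤ w u v) (w-diagonal : ∀ v → w v v ≡ 0ℚ) where

    open ∑ℚ
    open +-*-Solver using (solve; _:=_; _:+_; _:*_; _:-_; :-_; con)

    energy : Vector ℚ n → ℚ
    energy x = form w x x

    energy-cong : ∀ {x y} → (∀ v → x v ≡ y v) → energy x ≡ energy y
    energy-cong x≡y = form-cong w x≡y x≡y

    shift : Vector ℚ n → Fin n → Fin n → ℚ → Vector ℚ n
    shift x p q t v = x v + (t * unit p v - t * unit q v)

    -- The partial derivative of `energy` at `p`. It has two terms because `w` may fail to be
    -- symmetric: for a graph it records each edge in one order only.
    slope : Vector ℚ n → Fin n → ℚ
    slope x p = form w x (unit p) + form w (unit p) x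

    -- Since the diagonal of `w` vanishes, the quadratic term comes from `w p q` and `w q p` alone.
    -- Its negative sign is the concavity.
    energy-shift : ∀ x p q t →
      energy (shift x p q t) ≡
      energy x + t * (slope x p - slope x q) - t * t * (w p q + w q p)
    energy-shift x p q t = begin
      energy (shift x p q t)
        ≡⟨ energy-cong (λ v → solve 4 (λ x t a b → x :+ (t :* a :- t :* b) :=
             con 1ℚ :* x :+ (t :* a :+ ((:- t) :* b :+ con 0ℚ))) refl (x v) t (unit p v) (unit q v)) ⟩
      energy (combination α f)
        ≡⟨ form-combination w α f ⟩
      sum (λ i → α i * sum (λ j → α j * form w (f i) (f j)))
        ≡⟨ expand (form w x x) (form w x (unit p)) (form w (unit p) x)
             (form w x (unit q)) (form w (unit q) x)
             (unit-form p p) (unit-form p q) (unit-form q p) (unit-form q q) ⟩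
      energy x + t * (slope x p - slope x q) - t * t * (w p q + w q p) ∎
      where
      open ≡-Reasoning
      α : Vector ℚ 3
      α zero = 1ℚ
      α (suc zero) = t
      α (suc (suc zero)) = - t
      f : Fin 3 → Vector ℚ n
      f zero = x
      f (suc zero) = unit p
      f (suc (suc zero)) = unit q
      unit-form : ∀ u v → form w (unit u) (unit v) ≡ w u v
      unit-form = form-unit w
      expand : ∀ xx xp px xq qx {pp pq qp qq} →
        pp ≡ w p p → pq ≡ w p q → qp ≡ w q p → qq ≡ w q q →
        1ℚ * (1ℚ * xx + (t * xp + ((- t) * xq + 0ℚ))) +
        (t * (1ℚ * px + (t * pp + ((- t) * pq + 0ℚ))) +
        ((- t) * (1ℚ * qx + (t * qp + ((- t) * qq + 0ℚ))) + 0ℚ)) ≡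
        xx + t * ((xp + px) - (xq + qx)) - t * t * (w p q + w q p)
      expand xx xp px xq qx refl refl refl refl rewrite w-diagonal p | w-diagonal q =
        solve 8 (λ xx xp px xq qx t pq qp →
          con 1ℚ :* (con 1ℚ :* xx :+ (t :* xp :+ ((:- t) :* xq :+ con 0ℚ))) :+
          (t :* (con 1ℚ :* px :+ (t :* con 0ℚ :+ ((:- t) :* pq :+ con 0ℚ))) :+
          ((:- t) :* (con 1ℚ :* qx :+ (t :* qp :+ ((:- t) :* con 0ℚ :+ con 0ℚ))) :+ con 0ℚ)) :=
          xx :+ t :* ((xp :+ px) :- (xq :+ qx)) :- t :* t :* (pq :+ qp))
          refl xx xp px xq qx t (w p q) (w q p)

    Shifted : Vector ℚ n → Fin n → Fin n → Vector ℚ n → Set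
    Shifted x p q y =
      InBox y × sum y ≡ sum x × energy y ≤ energy x ×
      (∀ v → v ≢ p → v ≢ q → y v ≡ x v) × (Integral (y p) ⊎ Integral (y q))

    -- Along unit p - unit q the energy is concave, so moving mass downhill
    -- until a coordinate hits its bound never increases it.
    shift-downhill : ∀ x p q → p ≢ q → InBox x → slope x p ≤ slope x q → ∃[ y ] Shifted x p q y
    shift-downhill x p q p≢q box slope≤ =
      y , inBox , sum-y , energy-y , unchanged , hits
      where
      t = (1ℚ - x p) ⊓ x q
      y = shift x p q t

      0≤t : 0ℚ ≤ t
      0≤t = ℚ.⊓-glb (p≤q⇒0≤q-p (proj₂ (box p))) (proj₁ (box q))

      y-p : y p ≡ x p + t
      y-p rewrite unit-same p | unit-other (p≢q ∘ sym) =
        solve 2 (λ x t → x :+ (t :* con 1ℚ :- t :* con 0ℚ) := x :+ t) refl (x p) t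

      y-q : y q ≡ x q - t
      y-q rewrite unit-same q | unit-other p≢q =
        solve 2 (λ x t → x :+ (t :* con 0ℚ :- t :* con 1ℚ) := x :- t) refl (x q) t

      unchanged : ∀ v → v ≢ p → v ≢ q → y v ≡ x v
      unchanged v v≢p v≢q rewrite unit-other (v≢p ∘ sym) | unit-other (v≢q ∘ sym) =
        solve 2 (λ x t → x :+ (t :* con 0ℚ :- t :* con 0ℚ) := x) refl (x v) t

      sum-y : sum y ≡ sum x
      sum-y = begin
        sum y                                                        ≡⟨ ∑-distrib-+ x _ ⟩
        sum x + sum (λ v → t * unit p v - t * unit q v)              ≡⟨ cong (sum x +_) (sum-cong-≋ λ v →
          solve 3 (λ t a b → t :* a :- t :* b := t :* a :+ (:- t) :* b) refl t (unit p v) (unit q v)) ⟩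
        sum x + sum (λ v → t * unit p v + (- t) * unit q v)          ≡⟨ cong (sum x +_) (∑-distrib-+ (λ v → t * unit p v) _) ⟩
        sum x + (sum (λ v → t * unit p v) + sum (λ v → (- t) * unit q v)) ≡⟨ cong (sum x +_) (cong₂ _+_ (∑-*ˡ t (unit p)) (∑-*ˡ (- t) (unit q))) ⟩
        sum x + (t * sum (unit p) + (- t) * sum (unit q))            ≡⟨ cong (sum x +_) (cong₂ (λ a b → t * a + (- t) * b) (sum-unit p) (sum-unit q)) ⟩
        sum x + (t * 1ℚ + (- t) * 1ℚ)                                ≡⟨ solve 2 (λ s t → s :+ (t :* con 1ℚ :+ (:- t) :* con 1ℚ) := s) refl (sum x) t ⟩
        sum x                                                        ∎
        where open ≡-Reasoning

      energy-y : energy y ≤ energy x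
      energy-y = ≤-from-gap
        (t * (slope x q - slope x p) + t * t * (w p q + w q p))
        (0≤+ (0≤* 0≤t (p≤q⇒0≤q-p slope≤)) (0≤* (0≤* 0≤t 0≤t) (0≤+ (w≥0 p q) (w≥0 q p))))
        (trans
          (solve 5 (λ e t a b m → e := (e :+ t :* (a :- b) :- t :* t :* m) :+ (t :* (b :- a) :+ t :* t :* m))
            refl (energy x) t (slope x p) (slope x q) (w p q + w q p))
          (cong (_+ (t * (slope x q - slope x p) + t * t * (w p q + w q p))) (sym (energy-shift x p q t))))

      inBox : InBox y
      inBox v with v Fin.≟ p | v Fin.≟ q
      ... | yes refl | _ rewrite y-p =
        0≤+ (proj₁ (box p)) 0≤t ,
        ≤-from-gap ((1ℚ - x p) - t) (p≤q⇒0≤q-p (ℚ.p⊓q≤p (1ℚ - x p) (x q)))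
          (solve 2 (λ a t → con 1ℚ := (a :+ t) :+ ((con 1ℚ :- a) :- t)) refl (x p) t)
      ... | no _ | yes refl rewrite y-q =
        p≤q⇒0≤q-p (ℚ.p⊓q≤q (1ℚ - x p) (x q)) ,
        ≤-from-gap ((1ℚ - x q) + t) (0≤+ (p≤q⇒0≤q-p (proj₂ (box q))) 0≤t)
          (solve 2 (λ a t → con 1ℚ := (a :- t) :+ ((con 1ℚ :- a) :+ t)) refl (x q) t)
      ... | no v≢p | no v≢q rewrite unchanged v v≢p v≢q = box v

      hits : Integral (y p) ⊎ Integral (y q)
      hits with ℚ.≤-total (1ℚ - x p) (x q)
      ... | inj₁ l = inj₁ (inj₂ (trans y-p (trans (cong (x p +_) (ℚ.p≤q⇒p⊓q≡p l))
              (solve 1 (λ a → a :+ (con 1ℚ :- a) := con 1ℚ) refl (x p)))))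
      ... | inj₂ g = inj₂ (inj₁ (trans y-q (trans (cong (λ s → x q - s) (ℚ.p≥q⇒p⊓q≡q g)) (ℚ.+-inverseʳ (x q)))))

    shift-pair : ∀ x p q → p ≢ q → InBox x → ∃[ y ] Shifted x p q y
    shift-pair x p q p≢q box with ℚ.≤-total (slope x p) (slope x q)
    ... | inj₁ l = shift-downhill x p q p≢q box l
    ... | inj₂ g =
      let y , inBox , sum-y , energy-y , unchanged , hits = shift-downhill x q p (p≢q ∘ sym) box g
      in y , inBox , sum-y , energy-y , (λ v v≢p v≢q → unchanged v v≢q v≢p) , swap hits

    -- Only the vertices of `L` and one carried vertex `p` may still be fractional. A shift between
    -- `p` and the head of `L` settles one of the two, and the other is carried on.
    sweep : ∀ L p x → InBox x → (∀ v → v ∉ L → v ≢ p → Integral (x v)) →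
      ∃[ q ] ∃[ y ] (InBox y × sum y ≡ sum x × energy y ≤ energy x × (∀ v → v ≢ q → Integral (y v)))
    sweep [] p x box int = p , x , box , refl , ℚ.≤-refl , λ v → int v λ ()
    sweep (q ∷ L) p x box int with p Fin.≟ q
    ... | yes refl = sweep L p x box λ v v∉L v≢p →
            int v (λ { (here v≡p) → v≢p v≡p ; (there v∈L) → v∉L v∈L }) v≢p
    ... | no p≢q with shift-pair x p q p≢q box
    ...   | y , box′ , sum-y , energy-y , unchanged , hits =
      let r , z , box″ , sum-z , energy-z , int′ = continue hits
      in r , z , box″ , trans sum-z sum-y , ℚ.≤-trans energy-z energy-y , int′
      where
      old : ∀ v → v ∉ L → v ≢ p → v ≢ q → Integral (y v)
      old v v∉L v≢p v≢q = subst Integral (sym (unchanged v v≢p v≢q))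
        (int v (λ { (here v≡q) → v≢q v≡q ; (there v∈L) → v∉L v∈L }) v≢p)
      continue : Integral (y p) ⊎ Integral (y q) → _
      continue (inj₁ int-p) = sweep L q y box′ λ v v∉L v≢q → case-p v v∉L v≢q
        where
        case-p : ∀ v → v ∉ L → v ≢ q → Integral (y v)
        case-p v v∉L v≢q with v Fin.≟ p
        ... | yes refl = int-p
        ... | no v≢p = old v v∉L v≢p v≢q
      continue (inj₂ int-q) = sweep L p y box′ λ v v∉L v≢p → case-q v v∉L v≢p
        where
        case-q : ∀ v → v ∉ L → v ≢ p → Integral (y v)
        case-q v v∉L v≢p with v Fin.≟ q
        ... | yes refl = int-q
        ... | no v≢q = old v v∉L v≢p v≢q

    module _ (total : ℚ) where

      IsHalfℚ : Vector ℚ n → Set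
      IsHalfℚ x = InBox x × sum x ≡ total

      isHalfℚ? : ∀ x → Dec (IsHalfℚ x)
      isHalfℚ? x = Fin.all? (λ v → 0ℚ ℚ.≤? x v ×-dec x v ℚ.≤? 1ℚ) ×-dec (sum x ℚ.≟ total)

      private
        isHalfℚ-resp : ∀ {x y} → (∀ v → x v ≡ y v) → IsHalfℚ x → IsHalfℚ y
        isHalfℚ-resp x≡y (box , sum-x) =
          (λ v → subst (λ a → 0ℚ ≤ a × a ≤ 1ℚ) (x≡y v) (box v)) ,
          trans (sym (sum-cong-≋ x≡y)) sum-x

      bit : Fin 2 → ℚ
      bit zero    = 0ℚ
      bit (suc _) = 1ℚ

      -- s encodes a 0/1 vector; the entry at p is whatever makes the sum right.
      away : Fin n → Fin (2 ℕ.^ n) → Vector ℚ n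
      away p s v = (1ℚ - unit p v) * bit (Fin.finToFun s v)

      vertexLike : Fin n → Fin (2 ℕ.^ n) → Vector ℚ n
      vertexLike p s v = unit p v * (total - sum (away p s)) + away p s v

      candidates : List (Vector ℚ n)
      candidates = cartesianProductWith vertexLike (allFin n) (allFin (2 ℕ.^ n))

      private
        toBit : ℚ → Fin 2
        toBit a with a ℚ.≟ 0ℚ
        ... | yes _ = zero
        ... | no _  = suc zero

        bit-toBit : ∀ {a} → Integral a → bit (toBit a) ≡ a
        bit-toBit (inj₁ refl) = refl
        bit-toBit (inj₂ refl) = refl

      nearIntegral⇒vertexLike : ∀ p x → sum x ≡ total → (∀ v → v ≢ p → Integral (x v)) →
        ∃[ s ] (∀ v → x v ≡ vertexLike p s v)
      nearIntegral⇒vertexLike p x sum-x int = s , matches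
        where
        open ≡-Reasoning
        s = Fin.funToFin (toBit ∘ x)

        decoded : ∀ v → v ≢ p → bit (Fin.finToFun s v) ≡ x v
        decoded v v≢p = trans (cong bit (Fin.finToFun-funToFin (toBit ∘ x) v)) (bit-toBit (int v v≢p))

        split : ∀ v → x v ≡ unit p v * x p + away p s v
        split v with p Fin.≟ v
        ... | yes refl = solve 2 (λ a b → a := con 1ℚ :* a :+ (con 1ℚ :- con 1ℚ) :* b) refl (x p) (bit (Fin.finToFun s p))
        ... | no p≢v = trans (sym (decoded v (p≢v ∘ sym)))
                (solve 2 (λ a b → b := con 0ℚ :* a :+ (con 1ℚ :- con 0ℚ) :* b) refl (x p) (bit (Fin.finToFun s v)))

        x-p : x p ≡ total - sum (away p s)
        x-p = begin
          x p                                                ≡⟨ solve 2 (λ a b → a := (a :+ b) :- b) refl (x p) (sum (away p s)) ⟩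
          (x p + sum (away p s)) - sum (away p s)            ≡⟨ cong (λ a → (a + sum (away p s)) - sum (away p s)) (∑-unit p (λ _ → x p)) ⟨
          (sum (λ v → unit p v * x p) + sum (away p s)) - sum (away p s) ≡⟨ cong (_- sum (away p s)) (∑-distrib-+ (λ v → unit p v * x p) (away p s)) ⟨
          sum (λ v → unit p v * x p + away p s v) - sum (away p s) ≡⟨ cong (_- sum (away p s)) (sum-cong-≋ (sym ∘ split)) ⟩
          sum x - sum (away p s)                             ≡⟨ cong (_- sum (away p s)) sum-x ⟩
          total - sum (away p s)                             ∎

        matches : ∀ v → x v ≡ vertexLike p s v
        matches v = trans (split v) (cong (λ a → unit p v * a + away p s v) x-p)

      module _ (x₀ : Vector ℚ n) (half₀ : IsHalfℚ x₀) (p₀ : Fin n) where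

        private
          open Extrema (DecTotalOrder.totalOrder ℚ.≤-decTotalOrder) using (argmin; argmin-all; f[argmin]≤f[xs])
          halves : List (Vector ℚ n)
          halves = filter isHalfℚ? candidates

        -- The default `x₀` of `argmin` makes the result a half without a proof that some candidate
        -- passes the filter. The filter discards the candidates whose forced entry leaves the box.
        minimiser : Vector ℚ n
        minimiser = argmin energy x₀ halves

        minimiser-isHalf : IsHalfℚ minimiser
        minimiser-isHalf = argmin-all energy half₀ (all-filter isHalfℚ? candidates)

        -- The swept vector occurs among the candidates only up to pointwise equality, so being a
        -- half and the energy have to be transported along it.
        minimiser-least : ∀ x → IsHalfℚ x → energy minimiser ≤ energy x
        minimiser-least x (box , sum-x) =
          let p , y , box′ , sum-y , energy-y , int =
                sweep (allFin n) p₀ x box (λ v v∉ _ → contradiction (∈-allFin v) v∉)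
              sum-y≡total = trans sum-y sum-x
              s , y≡ = nearIntegral⇒vertexLike p y sum-y≡total int
              ∈halves = ∈-filter⁺ isHalfℚ?
                (∈-cartesianProductWith⁺ vertexLike (∈-allFin p) (∈-allFin s))
                (isHalfℚ-resp y≡ (box′ , sum-y≡total))
          in ℚ.≤-trans (All.lookup (f[argmin]≤f[xs] {f = energy} x₀ halves) ∈halves)
               (ℚ.≤-trans (ℚ.≤-reflexive (sym (energy-cong y≡))) energy-y)

-- Integers inside the rationals.

module IntegerEmbedding where

  open import Data.Integer as ℤ using (ℤ; +_)
  import Data.Integer.Properties as ℤ
  open import Data.Nat as ℕ using (suc; NonZero)
  import Data.Nat.Properties as ℕ
  open import Data.Rational using (ℚ; _/_; _+_; _*_; _≤_; 0ℚ; 1ℚ; toℚᵘ)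
  import Data.Rational.Properties as ℚ
  import Data.Rational.Unnormalised as ℚᵘ
  import Data.Rational.Unnormalised.Properties as ℚᵘ
  open import Relation.Binary.PropositionalEquality
  open import Data.Integer.Tactic.RingSolver using (solve-∀)

  ι : ℤ → ℚ
  ι i = i / 1

  private
    toℚᵘ-/ : ∀ i d .{{_ : NonZero d}} → toℚᵘ (i / d) ℚᵘ.≃ (i ℚᵘ./ d)
    toℚᵘ-/ i (suc d) = ℚ.toℚᵘ-fromℚᵘ (ℚᵘ.mkℚᵘ i d)

  -- Normalisation hides a gcd, which does not compute for variables. The identity is therefore
  -- checked on unnormalised fractions, where it is one between integers.
  ι-+ : ∀ i j → ι (i ℤ.+ j) ≡ ι i + ι j
  ι-+ i j = ℚ.toℚᵘ-injective (begin
    toℚᵘ (ι (i ℤ.+ j))              ≈⟨ toℚᵘ-/ (i ℤ.+ j) 1 ⟩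
    (i ℤ.+ j) ℚᵘ./ 1                ≈⟨ ℚᵘ.*≡* (lemma i j) ⟩
    (i ℚᵘ./ 1) ℚᵘ.+ (j ℚᵘ./ 1)      ≈⟨ ℚᵘ.+-cong (toℚᵘ-/ i 1) (toℚᵘ-/ j 1) ⟨
    toℚᵘ (ι i) ℚᵘ.+ toℚᵘ (ι j)      ≈⟨ ℚ.toℚᵘ-homo-+ (ι i) (ι j) ⟨
    toℚᵘ (ι i + ι j)                ∎)
    where
    open ℚᵘ.≃-Reasoning
    lemma : ∀ i j → (i ℤ.+ j) ℤ.* + 1 ≡ (i ℤ.* + 1 ℤ.+ j ℤ.* + 1) ℤ.* + 1
    lemma = solve-∀

  ι-* : ∀ i j → ι (i ℤ.* j) ≡ ι i * ι j
  ι-* i j = ℚ.toℚᵘ-injective (begin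
    toℚᵘ (ι (i ℤ.* j))              ≈⟨ toℚᵘ-/ (i ℤ.* j) 1 ⟩
    (i ℤ.* j) ℚᵘ./ 1                ≈⟨ ℚᵘ.≃-refl ⟩
    (i ℚᵘ./ 1) ℚᵘ.* (j ℚᵘ./ 1)      ≈⟨ ℚᵘ.*-cong (toℚᵘ-/ i 1) (toℚᵘ-/ j 1) ⟨
    toℚᵘ (ι i) ℚᵘ.* toℚᵘ (ι j)      ≈⟨ ℚ.toℚᵘ-homo-* (ι i) (ι j) ⟨
    toℚᵘ (ι i * ι j)                ∎)
    where open ℚᵘ.≃-Reasoning

  ι-mono : ∀ {i j} → i ℤ.≤ j → ι i ≤ ι j
  ι-mono {i} {j} i≤j = ℚ.toℚᵘ-cancel-≤ (begin
    toℚᵘ (ι i)  ≃⟨ toℚᵘ-/ i 1 ⟩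
    i ℚᵘ./ 1    ≤⟨ ℚᵘ.*≤* (ℤ.*-monoʳ-≤-nonNeg (+ 1) i≤j) ⟩
    j ℚᵘ./ 1    ≃⟨ toℚᵘ-/ j 1 ⟨
    toℚᵘ (ι j)  ∎)
    where open ℚᵘ.≤-Reasoning

  /*ι : ∀ i d .{{_ : NonZero d}} → (i / d) * ι (+ d) ≡ ι i
  /*ι i d@(suc _) = ℚ.toℚᵘ-injective (begin
    toℚᵘ ((i / d) * ι (+ d))               ≈⟨ ℚ.toℚᵘ-homo-* (i / d) (ι (+ d)) ⟩
    toℚᵘ (i / d) ℚᵘ.* toℚᵘ (ι (+ d))       ≈⟨ ℚᵘ.*-cong (toℚᵘ-/ i d) (toℚᵘ-/ (+ d) 1) ⟩
    (i ℚᵘ./ d) ℚᵘ.* (+ d ℚᵘ./ 1)           ≈⟨ ℚᵘ.*≡* (cancel i (+ d)) ⟩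
    i ℚᵘ./ 1                               ≈⟨ toℚᵘ-/ i 1 ⟨
    toℚᵘ (ι i)                             ∎)
    where
    open ℚᵘ.≃-Reasoning
    cancel : ∀ i d → (i ℤ.* d) ℤ.* + 1 ≡ i ℤ.* (d ℤ.* + 1)
    cancel = solve-∀

  -- Literally the prefactor in `density`, instance argument included, so that the two agree
  -- definitionally.
  n⁻² : ∀ n .{{_ : NonZero n}} → ℚ
  n⁻² n = _/_ (+ 1) (n ℕ.* n) {{ℕ.m*n≢0 n n}}

  0≤n⁻² : ∀ n .{{_ : NonZero n}} → 0ℚ ≤ n⁻² n
  0≤n⁻² n = ℚ.nonNegative⁻¹ (n⁻² n) {{ℚ.normalize-nonNeg 1 (n ℕ.* n) {{ℕ.m*n≢0 n n}}}}

  n⁻²*n² : ∀ n .{{_ : NonZero n}} → n⁻² n * ι (+ n ℤ.* + n) ≡ 1ℚ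
  n⁻²*n² n = trans (cong (λ i → n⁻² n * ι i) (sym (ℤ.pos-* n n)))
    (/*ι (+ 1) (n ℕ.* n) {{ℕ.m*n≢0 n n}})

-- Existence of β, and its bound by a single rational half.

module RationalHalves where

  open LinearAlgebra
  open RationalRounding
  open IntegerEmbedding
  import Defs as ℝ
  open ℝ using (ℝ; seq; Graph; adj; irreflexive; IsHalf; edgeWeight; density; fromℚ; _Isβ_)
  open import Data.Bool using (Bool; true; false; _∧_; if_then_else_)
  open import Data.Fin as Fin using (Fin; zero; suc)
  import Data.Fin.Properties as Fin
  open import Data.Integer as ℤ using (ℤ)
  import Data.Integer.Properties as ℤ
  open import Data.Nat as ℕ using (ℕ; zero; suc; NonZero)
  import Data.Nat.Properties as ℕ
  open import Data.Product using (_×_; _,_; ∃-syntax; proj₁; proj₂)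
  open import Data.Rational as ℚ hiding (NonZero)
  import Data.Rational.Properties as ℚ
  open import Data.Rational.Solver using (module +-*-Solver)
  open import Data.Sum using (inj₁; inj₂)
  open import Data.Vec.Functional using (Vector)
  open import Function using (_∘_)
  open import Relation.Binary.PropositionalEquality
  open import Relation.Nullary using (does)

  seq-sum : ∀ {n} (f : Vector ℝ n) i → seq (ℝ.sum f) i ≡ ∑ℚ.sum (λ v → seq (f v) i)
  seq-sum {zero}  f i = refl
  seq-sum {suc n} f i = cong (seq (f zero) i +_) (seq-sum (f ∘ suc) i)

  ∑ℚ-const : ∀ n c → ∑ℚ.sum {n} (λ _ → c) ≡ ι (ℤ.+ n) * c
  ∑ℚ-const zero    c = sym (ℚ.*-zeroˡ c)
  ∑ℚ-const (suc n) c = begin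
    c + ∑ℚ.sum {n} (λ _ → c)   ≡⟨ cong₂ _+_ (sym (ℚ.*-identityˡ c)) (∑ℚ-const n c) ⟩
    1ℚ * c + ι (ℤ.+ n) * c       ≡⟨ ℚ.*-distribʳ-+ c 1ℚ (ι (ℤ.+ n)) ⟨
    (ι (ℤ.+ 1) + ι (ℤ.+ n)) * c    ≡⟨ cong (_* c) (ι-+ (ℤ.+ 1) (ℤ.+ n)) ⟨
    ι (ℤ.+ suc n) * c            ∎
    where open ≡-Reasoning

  seq-≤ : ∀ x y → (∀ i → seq x i ≤ seq y i) → x ℝ.≤ y
  seq-≤ x y x≤y ε = 0 , λ i _ → ℚ.≤-trans (x≤y i) (p≤p+q (ℚ.<⇒≤ (ℚ.positive⁻¹ ε)))

  eventually-∀ : ∀ {n} {P : Fin n → ℕ → Set} →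
    (∀ v → ∃[ N ] (∀ i → N ℕ.≤ i → P v i)) → ∃[ N ] (∀ i → N ℕ.≤ i → ∀ v → P v i)
  eventually-∀ {zero}  h = 0 , λ _ _ ()
  eventually-∀ {suc n} h =
    let M , hM = h zero
        N , hN = eventually-∀ (h ∘ suc)
    in M ℕ.⊔ N , λ { i ≤i zero    → hM i (ℕ.m⊔n≤o⇒m≤o M N ≤i)
                   ; i ≤i (suc v) → hN i (ℕ.m⊔n≤o⇒n≤o M N ≤i) v }

  ⊓-pos : ∀ p q .{{_ : Positive p}} .{{_ : Positive q}} → Positive (p ⊓ q)
  ⊓-pos p q {{p>0}} {{q>0}} with ℚ.⊓-sel p q
  ... | inj₁ e = subst Positive (sym e) (ℚ.positive (ℚ.positive⁻¹ p))
  ... | inj₂ e = subst Positive (sym e) (ℚ.positive (ℚ.positive⁻¹ q))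

  module _ {n : ℕ} (G : Graph n) where

    edge : Fin n → Fin n → Bool
    edge u v = adj G u v ∧ does (u Fin.<? v)

    edge-weight : Fin n → Fin n → ℚ
    edge-weight u v = ∑ℚ.⟦ edge u v ⟧

    private
      ⟦⟧≥0 : ∀ b → 0ℚ ≤ ∑ℚ.⟦ b ⟧
      ⟦⟧≥0 true  = ℚ.nonNegative⁻¹ 1ℚ
      ⟦⟧≥0 false = ℚ.≤-refl

      edge-weight≥0 : ∀ u v → 0ℚ ≤ edge-weight u v
      edge-weight≥0 u v = ⟦⟧≥0 (edge u v)

      edge-weight-diagonal : ∀ v → edge-weight v v ≡ 0ℚ
      edge-weight-diagonal v rewrite irreflexive G v = refl

    open Rounding edge-weight edge-weight≥0 edge-weight-diagonal public

    open ∑ℚ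
    open +-*-Solver using (solve; _:=_; _:+_; _:*_; _:-_; :-_; con)

    -- Real arithmetic is termwise, so every approximant of the real edge weight is the rational
    -- energy of a vector of approximants.
    seq-edgeWeight : ∀ μ i → seq (edgeWeight G μ) i ≡ energy (λ v → seq (μ v) i)
    seq-edgeWeight μ i = begin
      seq (edgeWeight G μ) i
        ≡⟨ seq-sum (λ u → ℝ.sum λ v → if edge u v then μ u ℝ.* μ v else ℝ.0ℝ) i ⟩
      sum {n} (λ u → seq (ℝ.sum λ v → if edge u v then μ u ℝ.* μ v else ℝ.0ℝ) i)
        ≡⟨ (sum-cong-≋ λ u → seq-sum (λ v → if edge u v then μ u ℝ.* μ v else ℝ.0ℝ) i) ⟩
      sum {n} (λ u → sum {n} λ v → seq (if edge u v then μ u ℝ.* μ v else ℝ.0ℝ) i)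
        ≡⟨ (sum-cong-≋ λ u → sum-cong-≋ λ v → term (edge u v) (μ u) (μ v)) ⟩
      energy (λ v → seq (μ v) i) ∎
      where
      open ≡-Reasoning
      term : ∀ b x y → seq (if b then x ℝ.* y else ℝ.0ℝ) i ≡ ⟦ b ⟧ * (seq x i * seq y i)
      term true  x y = sym (ℚ.*-identityˡ _)
      term false x y = sym (ℚ.*-zeroˡ (seq x i * seq y i))

    energy-scale : ∀ a x → energy (λ v → a * x v) ≡ a * a * energy x
    energy-scale a x = begin
      energy (λ v → a * x v)                              ≡⟨ energy-cong (λ v → sym (ℚ.+-identityʳ (a * x v))) ⟩
      energy (combination {1} (λ _ → a) (λ _ → x))        ≡⟨ form-combination {m = 1} edge-weight (λ _ → a) (λ _ → x) ⟩
      a * (a * energy x + 0ℚ) + 0ℚ                        ≡⟨ solve 2 (λ a e → a :* (a :* e :+ con 0ℚ) :+ con 0ℚ := a :* a :* e) refl a (energy x) ⟩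
      a * a * energy x                                    ∎
      where open ≡-Reasoning

    energy-nonneg : ∀ {x} → (∀ v → 0ℚ ≤ x v) → 0ℚ ≤ energy x
    energy-nonneg 0≤x = ∑ℚ-nonneg λ u → ∑ℚ-nonneg λ v →
      0≤* (edge-weight≥0 u v) (0≤* (0≤x u) (0≤x v))

    module _ .{{_ : NonZero n}} where

      private
        ν half : ℚ
        ν = ι (ℤ.+ n)
        half = ℤ.+ n / 2

        half+half : half + half ≡ ν
        half+half = trans (solve 1 (λ h → h :+ h := h :* (con 1ℚ :+ con 1ℚ)) refl half) (/*ι (ℤ.+ n) 2)

        1≤ν : 1ℚ ≤ ν
        1≤ν = ι-mono (ℤ.+≤+ (ℕ.>-nonZero⁻¹ n))

        0≤half : 0ℚ ≤ half
        0≤half = ℚ.*-cancelʳ-≤-pos (ι (ℤ.+ 2)) (subst (0ℚ * ι (ℤ.+ 2) ≤_) (sym (/*ι (ℤ.+ n) 2))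
          (ℚ.≤-trans (ℚ.nonNegative⁻¹ 1ℚ) 1≤ν))

      -- Here `x` stands for the approximant of a real half at one index: it obeys the box
      -- conditions and the lower bound on the sum up to an error `δ`. It is raised by 3δ to `z`,
      -- then scaled down to an exact half `y`.
      module Perturb (x : Vector ℚ n) (δ : ℚ) (0≤δ : 0ℚ ≤ δ) (δ≤1 : δ ≤ 1ℚ)
        (x≥ : ∀ v → 0ℚ ≤ x v + δ) (x≤ : ∀ v → x v ≤ 1ℚ + δ) (sum-x : half ≤ sum x + δ) where

        z : Vector ℚ n
        z v = x v + ι (ℤ.+ 3) * δ

        private
          0≤2δ : 0ℚ ≤ ι (ℤ.+ 2) * δ
          0≤2δ = 0≤* (ℚ.nonNegative⁻¹ (ι (ℤ.+ 2))) 0≤δ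

          0≤4δ : 0ℚ ≤ ι (ℤ.+ 4) * δ
          0≤4δ = 0≤* (ℚ.nonNegative⁻¹ (ι (ℤ.+ 4))) 0≤δ

        z≥0 : ∀ v → 0ℚ ≤ z v
        z≥0 v = subst (0ℚ ≤_) (solve 2 (λ x d → x :+ d :+ con (ι (ℤ.+ 2)) :* d := x :+ con (ι (ℤ.+ 3)) :* d) refl (x v) δ)
          (0≤+ (x≥ v) 0≤2δ)

        z≤ : ∀ v → z v ≤ 1ℚ + ι (ℤ.+ 4) * δ
        z≤ v = ≤-from-gap ((1ℚ + δ) - x v) (p≤q⇒0≤q-p (x≤ v))
          (solve 2 (λ x d → con 1ℚ :+ con (ι (ℤ.+ 4)) :* d := (x :+ con (ι (ℤ.+ 3)) :* d) :+ ((con 1ℚ :+ d) :- x)) refl (x v) δ)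

        sum-z : sum z ≡ sum x + ν * (ι (ℤ.+ 3) * δ)
        sum-z = trans (∑-distrib-+ x (λ _ → ι (ℤ.+ 3) * δ)) (cong (λ s → sum x + s) (∑ℚ-const n (ι (ℤ.+ 3) * δ)))

        -- The slack 3δ is what makes z, rescaled to total n / 2, lie in the box.
        half-z : half * (1ℚ + ι (ℤ.+ 4) * δ) ≤ sum z
        half-z = ≤-from-gap ((sum x + δ - half) + δ * (ν - 1ℚ))
          (0≤+ (p≤q⇒0≤q-p sum-x) (0≤* 0≤δ (p≤q⇒0≤q-p 1≤ν)))
          (trans sum-z (trans (cong (λ a → sum x + a * (ι (ℤ.+ 3) * δ)) (sym half+half)) (trans
            (solve 3 (λ s h d → s :+ (h :+ h) :* (con (ι (ℤ.+ 3)) :* d) :=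
                h :* (con 1ℚ :+ con (ι (ℤ.+ 4)) :* d) :+ ((s :+ d :- h) :+ d :* ((h :+ h) :- con 1ℚ)))
              refl (sum x) half δ)
            (cong (λ a → half * (1ℚ + ι (ℤ.+ 4) * δ) + ((sum x + δ - half) + δ * (a - 1ℚ))) half+half))))

        half≤T : half ≤ sum z
        half≤T = ℚ.≤-trans (≤-from-gap (half * (ι (ℤ.+ 4) * δ)) (0≤* 0≤half 0≤4δ)
          (solve 2 (λ h d → h :* (con 1ℚ :+ d) := h :+ h :* d) refl half (ι (ℤ.+ 4) * δ))) half-z

        private
          0<half : 0ℚ < half
          0<half = ℚ.*-cancelʳ-<-nonNeg (ι (ℤ.+ 2)) (subst (0ℚ * ι (ℤ.+ 2) <_) (sym (/*ι (ℤ.+ n) 2))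
            (ℚ.<-≤-trans (ℚ.positive⁻¹ 1ℚ) 1≤ν))
          instance
            T>0 : Positive (sum z)
            T>0 = ℚ.positive (ℚ.<-≤-trans 0<half half≤T)
            T≢0 : ℚ.NonZero (sum z)
            T≢0 = ℚ.pos⇒nonZero (sum z)

        s : ℚ
        s = half * 1/ (sum z)

        s*T : s * sum z ≡ half
        s*T = trans (ℚ.*-assoc half (1/ sum z) (sum z))
          (trans (cong (half *_) (ℚ.*-inverseˡ (sum z))) (ℚ.*-identityʳ half))

        0≤s : 0ℚ ≤ s
        0≤s = 0≤* 0≤half (ℚ.<⇒≤ (ℚ.positive⁻¹ (1/ sum z) {{ℚ.1/pos⇒pos (sum z)}}))

        s≤1 : s ≤ 1ℚ
        s≤1 = ℚ.*-cancelʳ-≤-pos (sum z) (subst₂ _≤_ (sym s*T) (sym (ℚ.*-identityˡ (sum z))) half≤T)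

        y : Vector ℚ n
        y v = s * z v

        y-isHalf : IsHalfℚ half y
        y-isHalf = (λ v → 0≤* 0≤s (z≥0 v) , ℚ.*-cancelʳ-≤-pos (sum z) (y≤ v)) ,
          trans (∑-*ˡ s z) s*T
          where
          open ℚ.≤-Reasoning
          y≤ : ∀ v → y v * sum z ≤ 1ℚ * sum z
          y≤ v = begin
            s * z v * sum z               ≡⟨ solve 3 (λ s z t → s :* z :* t := (s :* t) :* z) refl s (z v) (sum z) ⟩
            s * sum z * z v               ≡⟨ cong (_* z v) s*T ⟩
            half * z v                    ≤⟨ ℚ.*-monoˡ-≤-nonNeg half {{nonNegative 0≤half}} (z≤ v) ⟩
            half * (1ℚ + ι (ℤ.+ 4) * δ)     ≤⟨ half-z ⟩
            sum z                         ≡⟨ ℚ.*-identityˡ (sum z) ⟨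
            1ℚ * sum z                    ∎

        energy-y : energy y ≤ energy z
        energy-y = ≤-from-gap ((1ℚ - s) * (1ℚ + s) * energy z)
          (0≤* (0≤* (p≤q⇒0≤q-p s≤1) (0≤+ (ℚ.nonNegative⁻¹ 1ℚ) 0≤s)) (energy-nonneg z≥0))
          (trans (solve 2 (λ s e → e := s :* s :* e :+ (con 1ℚ :- s) :* (con 1ℚ :+ s) :* e) refl s (energy z))
            (cong (_+ (1ℚ - s) * (1ℚ + s) * energy z) (sym (energy-scale s z))))

        -- The error is charged to all n² ordered pairs, edges or not, so that the factor 1/n² of
        -- the density reduces it to 21δ.
        energy-z : energy z ≤ energy x + ν * ν * (ι (ℤ.+ 21) * δ)
        energy-z = begin
          energy z
            ≤⟨ (∑ℚ-mono λ u → ∑ℚ-mono λ v → term (edge u v) u v) ⟩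
          sum {n} (λ u → sum {n} λ v → edge-weight u v * (x u * x v) + ι (ℤ.+ 21) * δ)
            ≡⟨ (sum-cong-≋ λ u → trans (∑-distrib-+ (λ v → edge-weight u v * (x u * x v)) (λ _ → ι (ℤ.+ 21) * δ))
                 (cong (sum (λ v → edge-weight u v * (x u * x v)) +_) (∑ℚ-const n (ι (ℤ.+ 21) * δ)))) ⟩
          sum {n} (λ u → sum {n} (λ v → edge-weight u v * (x u * x v)) + ν * (ι (ℤ.+ 21) * δ))
            ≡⟨ trans (∑-distrib-+ (λ u → sum {n} (λ v → edge-weight u v * (x u * x v))) (λ _ → ν * (ι (ℤ.+ 21) * δ)))
                 (cong (energy x +_) (∑ℚ-const n (ν * (ι (ℤ.+ 21) * δ)))) ⟩
          energy x + ν * (ν * (ι (ℤ.+ 21) * δ))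
            ≡⟨ cong (energy x +_) (ℚ.*-assoc ν ν (ι (ℤ.+ 21) * δ)) ⟨
          energy x + ν * ν * (ι (ℤ.+ 21) * δ) ∎
          where
          open ℚ.≤-Reasoning
          term : ∀ b u v → ⟦ b ⟧ * (z u * z v) ≤ ⟦ b ⟧ * (x u * x v) + ι (ℤ.+ 21) * δ
          term false u v = subst₂ _≤_ (sym (ℚ.*-zeroˡ (z u * z v)))
            (trans (sym (ℚ.+-identityˡ (ι (ℤ.+ 21) * δ))) (cong (_+ ι (ℤ.+ 21) * δ) (sym (ℚ.*-zeroˡ (x u * x v)))))
            (0≤* (ℚ.nonNegative⁻¹ (ι (ℤ.+ 21))) 0≤δ)
          -- With a and b the two values of `x`, the increase is 3δ(a + b) + 9δ². Since a, b ≤ 1 + δ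
          -- and δ ≤ 1, it is at most 6δ + 15δ² ≤ 21δ.
          term true u v = ≤-from-gap
            (ι (ℤ.+ 3) * δ * (((1ℚ + δ) - x u) + ((1ℚ + δ) - x v)) + ι (ℤ.+ 15) * δ * (1ℚ - δ))
            (0≤+ (0≤* (0≤* (ℚ.nonNegative⁻¹ (ι (ℤ.+ 3))) 0≤δ)
                    (0≤+ (p≤q⇒0≤q-p (x≤ u)) (p≤q⇒0≤q-p (x≤ v))))
                 (0≤* (0≤* (ℚ.nonNegative⁻¹ (ι (ℤ.+ 15))) 0≤δ) (p≤q⇒0≤q-p δ≤1)))
            (solve 3 (λ a b d →
                con 1ℚ :* (a :* b) :+ con (ι (ℤ.+ 21)) :* d :=
                con 1ℚ :* ((a :+ con (ι (ℤ.+ 3)) :* d) :* (b :+ con (ι (ℤ.+ 3)) :* d)) :+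
                (con (ι (ℤ.+ 3)) :* d :* (((con 1ℚ :+ d) :- a) :+ ((con 1ℚ :+ d) :- b)) :+
                 con (ι (ℤ.+ 15)) :* d :* (con 1ℚ :- d)))
              refl (x u) (x v) δ)

      private
        κ : ℚ
        κ = n⁻² n

        0≤κ : 0ℚ ≤ κ
        0≤κ = 0≤n⁻² n

        κ*ν*ν : κ * (ν * ν) ≡ 1ℚ
        κ*ν*ν = trans (cong (κ *_) (sym (ι-* (ℤ.+ n) (ℤ.+ n)))) (n⁻²*n² n)

        ≤-trans : ∀ {x y z} → x ℝ.≤ y → y ℝ.≤ z → x ℝ.≤ z
        ≤-trans {x} {y} {z} x≤y y≤z ε =
          let instance _ = ℚ.pos*pos⇒pos ½ ε
              M , hM = x≤y (½ * ε)
              N , hN = y≤z (½ * ε)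
          in M ℕ.⊔ N , λ i ≤i → begin
            seq x i                        ≤⟨ hM i (ℕ.m⊔n≤o⇒m≤o M N ≤i) ⟩
            seq y i + ½ * ε                ≤⟨ ℚ.+-monoˡ-≤ (½ * ε) (hN i (ℕ.m⊔n≤o⇒n≤o M N ≤i)) ⟩
            (seq z i + ½ * ε) + ½ * ε      ≡⟨ solve 2 (λ z e → (z :+ con ½ :* e) :+ con ½ :* e := z :+ e) refl (seq z i) ε ⟩
            seq z i + ε                    ∎
          where open ℚ.≤-Reasoning

      module _ (x₀ : Vector ℚ n) (half₀ : IsHalfℚ half x₀) where

        private
          p₀ : Fin n
          p₀ = Fin.fromℕ< (ℕ.>-nonZero⁻¹ n)

          m : Vector ℚ n
          m = minimiser half x₀ half₀ p₀

          m-isHalf : IsHalfℚ half m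
          m-isHalf = minimiser-isHalf half x₀ half₀ p₀

          m-least : ∀ x → IsHalfℚ half x → energy m ≤ energy x
          m-least = minimiser-least half x₀ half₀ p₀

          b : ℝ
          b = fromℚ (κ * energy m)

          -- No limit is taken: at every late index the approximant of `μ` is corrected by
          -- `Perturb`, and the corrected half is compared with the rational minimum.
          b≤density : ∀ μ → IsHalf μ → b ℝ.≤ density G μ
          b≤density μ (box , (_ , half≤sum)) ε =
            let L , hL = eventually-∀ λ v → proj₁ (box v) δ
                M , hM = eventually-∀ λ v → proj₂ (box v) δ
                N , hN = half≤sum δ
            in (L ℕ.⊔ M) ℕ.⊔ N , λ i ≤i →
              let LM≤i = ℕ.m⊔n≤o⇒m≤o (L ℕ.⊔ M) N ≤i
              in bound i (hL i (ℕ.m⊔n≤o⇒m≤o L M LM≤i)) (hM i (ℕ.m⊔n≤o⇒n≤o L M LM≤i))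
                   (subst (λ a → half ≤ a + δ) (seq-sum μ i) (hN i (ℕ.m⊔n≤o⇒n≤o (L ℕ.⊔ M) N ≤i)))
            where
            open ℚ.≤-Reasoning
            -- The 21 is the constant of `energy-z`; the cap at 1 in `δ` provides the hypothesis
            -- `δ≤1` of `Perturb`.
            ε′ = (ℤ.+ 1 / 21) * ε
            δ = ε′ ⊓ 1ℚ
            instance
              δ>0 : Positive δ
              δ>0 = ⊓-pos ε′ 1ℚ {{ℚ.pos*pos⇒pos (ℤ.+ 1 / 21) ε}}
            bound : ∀ i → (∀ v → 0ℚ ≤ seq (μ v) i + δ) → (∀ v → seq (μ v) i ≤ 1ℚ + δ) →
              half ≤ sum (λ v → seq (μ v) i) + δ →
              κ * energy m ≤ κ * seq (edgeWeight G μ) i + ε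
            bound i x≥ x≤ sum-x = begin
              κ * energy m                                  ≤⟨ ℚ.*-monoˡ-≤-nonNeg κ {{nonNegative 0≤κ}} (m-least y y-isHalf) ⟩
              κ * energy y                                  ≤⟨ ℚ.*-monoˡ-≤-nonNeg κ {{nonNegative 0≤κ}} (ℚ.≤-trans energy-y energy-z) ⟩
              κ * (energy x + ν * ν * (ι (ℤ.+ 21) * δ))            ≡⟨ solve 4 (λ k e v d → k :* (e :+ v :* d) := k :* e :+ (k :* v) :* d) refl κ (energy x) (ν * ν) (ι (ℤ.+ 21) * δ) ⟩
              κ * energy x + κ * (ν * ν) * (ι (ℤ.+ 21) * δ)        ≡⟨ cong₂ (λ e c → κ * e + c * (ι (ℤ.+ 21) * δ)) (sym (seq-edgeWeight μ i)) κ*ν*ν ⟩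
              κ * seq (edgeWeight G μ) i + 1ℚ * (ι (ℤ.+ 21) * δ)   ≤⟨ ℚ.+-monoʳ-≤ (κ * seq (edgeWeight G μ) i) slack≤ε ⟩
              κ * seq (edgeWeight G μ) i + ε                ∎
              where
              x : Vector ℚ n
              x v = seq (μ v) i
              open Perturb x δ (ℚ.<⇒≤ (ℚ.positive⁻¹ δ)) (ℚ.p⊓q≤q ε′ 1ℚ) x≥ x≤ sum-x
              slack≤ε : 1ℚ * (ι (ℤ.+ 21) * δ) ≤ ε
              slack≤ε = begin
                1ℚ * (ι (ℤ.+ 21) * δ)   ≡⟨ ℚ.*-identityˡ (ι (ℤ.+ 21) * δ) ⟩
                ι (ℤ.+ 21) * δ          ≤⟨ ℚ.*-monoˡ-≤-nonNeg (ι (ℤ.+ 21)) (ℚ.p⊓q≤p ε′ 1ℚ) ⟩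
                ι (ℤ.+ 21) * ε′         ≡⟨ ℚ.*-assoc (ι (ℤ.+ 21)) (ℤ.+ 1 / 21) ε ⟨
                1ℚ * ε           ≡⟨ ℚ.*-identityˡ ε ⟩
                ε                ∎

          constant-half : IsHalf (λ v → fromℚ (m v))
          constant-half =
            (λ v → seq-≤ ℝ.0ℝ (fromℚ (m v)) (λ _ → proj₁ (proj₁ m-isHalf v)) ,
                   seq-≤ (fromℚ (m v)) ℝ.1ℝ (λ _ → proj₂ (proj₁ m-isHalf v))) ,
            seq-≤ (ℝ.sum (λ v → fromℚ (m v))) (fromℚ half) (λ i → ℚ.≤-reflexive (sum≡ i)) ,
            seq-≤ (fromℚ half) (ℝ.sum (λ v → fromℚ (m v))) (λ i → ℚ.≤-reflexive (sym (sum≡ i)))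
            where
            sum≡ : ∀ i → seq (ℝ.sum (λ v → fromℚ (m v))) i ≡ half
            sum≡ i = trans (seq-sum (λ v → fromℚ (m v)) i) (proj₂ m-isHalf)

          density≈b : density G (λ v → fromℚ (m v)) ℝ.≈ b
          density≈b =
            seq-≤ (density G (λ v → fromℚ (m v))) b (λ i → ℚ.≤-reflexive (density≡ i)) ,
            seq-≤ b (density G (λ v → fromℚ (m v))) (λ i → ℚ.≤-reflexive (sym (density≡ i)))
            where
            density≡ : ∀ i → seq (density G (λ v → fromℚ (m v))) i ≡ κ * energy m
            density≡ i = cong (κ *_) (seq-edgeWeight (λ v → fromℚ (m v)) i)

        -- The minimiser, read as a vector of constant sequences, attains the value that `b≤density`
        -- shows to be a lower bound. The half `x₀` serves twice: as the default of the search and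
        -- as the competitor that gives the bound `q`.
        β-exists-below : ∀ {q} → κ * energy x₀ ≤ q → ∃[ b ] (b Isβ G × b ℝ.≤ fromℚ q)
        β-exists-below {q} x₀≤q = b ,
          (((λ v → fromℚ (m v)) , constant-half , density≈b) , least) ,
          seq-≤ b (fromℚ q) λ _ → ℚ.≤-trans (ℚ.*-monoˡ-≤-nonNeg κ {{nonNegative 0≤κ}} (m-least x₀ half₀)) x₀≤q
          where
          least : ∀ x → ∃[ μ ] (IsHalf μ × density G μ ℝ.≈ x) → b ℝ.≤ x
          least x (μ , μ-isHalf , (d≤x , _)) = ≤-trans {b} {density G μ} {x} (b≤density μ μ-isHalf) d≤x

-- Halves with integral weights over a common denominator.

module IntegralHalves where

  open LinearAlgebra
  open RationalRounding
  open IntegerEmbedding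
  open RationalHalves
  import Defs as ℝ
  open ℝ using (Graph; adj; irreflexive; symmetric; fromℚ; _Isβ_)
  open import Data.Bool using (true; false; _∧_)
  open import Data.Fin as Fin using (Fin; zero; suc)
  import Data.Fin.Properties as Fin
  open import Data.Integer as ℤ using (ℤ)
  import Data.Integer.Properties as ℤ
  open import Data.Nat as ℕ using (ℕ; zero; suc; NonZero)
  import Data.Nat.Properties as ℕ
  open import Data.Product using (_×_; _,_; ∃-syntax)
  open import Data.Rational as ℚ hiding (NonZero)
  import Data.Rational.Properties as ℚ
  open import Data.Rational.Solver using (module +-*-Solver)
  open import Data.Vec.Functional using (Vector)
  open import Function using (_∘_)
  open import Relation.Binary.Definitions using (tri<; tri≈; tri>)
  open import Relation.Binary.PropositionalEquality
  open import Relation.Nullary.Decidable using (dec-true; dec-false)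

  module ∑ℤ = BilinearForm ℤ.+-*-commutativeRing

  ι-sum : ∀ {n} (f : Vector ℤ n) → ι (∑ℤ.sum f) ≡ ∑ℚ.sum (ι ∘ f)
  ι-sum {zero}  f = refl
  ι-sum {suc n} f = trans (ι-+ (f zero) (∑ℤ.sum (f ∘ suc))) (cong (ι (f zero) +_) (ι-sum (f ∘ suc)))

  module _ {n : ℕ} (G : Graph n) where

    A : Fin n → Fin n → ℤ
    A u v = ∑ℤ.⟦ adj G u v ⟧

    -- The form of `A` counts every edge twice, so the density is `form A weight weight` divided by
    -- 2n²d², where d is the denominator. The field `sparse` bounds this by 1/50 without division.
    record IntegralHalf : Set where
      field
        denominator   : ℕ
        .{{denominator≢0}} : NonZero denominator
        weight        : Vector ℤ n
        nonneg        : ∀ v → ℤ.0ℤ ℤ.≤ weight v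
        bounded       : ∀ v → weight v ℤ.≤ ℤ.+ denominator
        total         : ℤ.+ 2 ℤ.* ∑ℤ.sum weight ≡ ℤ.+ n ℤ.* ℤ.+ denominator
        sparse        : ℤ.+ 25 ℤ.* ∑ℤ.form A weight weight ℤ.≤
                        (ℤ.+ n ℤ.* ℤ.+ n) ℤ.* (ℤ.+ denominator ℤ.* ℤ.+ denominator)

    private
      ⟦⟧+⟦⟧ : ∀ u v → edge-weight G u v + edge-weight G v u ≡ ι (A u v)
      ⟦⟧+⟦⟧ u v rewrite symmetric G v u with ℕ.<-cmp (Fin.toℕ u) (Fin.toℕ v)
      ... | tri< u<v _ v≮u rewrite dec-true (u Fin.<? v) u<v | dec-false (v Fin.<? u) v≮u = lemma (adj G u v)
        where
        lemma : ∀ b → ∑ℚ.⟦ b ∧ true ⟧ + ∑ℚ.⟦ b ∧ false ⟧ ≡ ι (∑ℤ.⟦ b ⟧)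
        lemma true  = refl
        lemma false = refl
      ... | tri> u≮v _ v<u rewrite dec-false (u Fin.<? v) u≮v | dec-true (v Fin.<? u) v<u = lemma (adj G u v)
        where
        lemma : ∀ b → ∑ℚ.⟦ b ∧ false ⟧ + ∑ℚ.⟦ b ∧ true ⟧ ≡ ι (∑ℤ.⟦ b ⟧)
        lemma true  = refl
        lemma false = refl
      ... | tri≈ _ u≡v _ with Fin.toℕ-injective u≡v
      ...   | refl rewrite irreflexive G u = refl

    open ∑ℚ using (sum; sum-cong-≋; ∑-distrib-+; ∑-comm; ∑-*ʳ)
    open +-*-Solver using (solve; _:=_; _:+_; _:*_; _:-_; :-_; con)

    -- A transposed copy of the energy is added to it. The condition `u < v` then disappears, and
    -- the symmetric matrix `A` remains.
    energy-ι : ∀ X → energy G (ι ∘ X) + energy G (ι ∘ X) ≡ ι (∑ℤ.form A X X)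
    energy-ι X = begin
      energy G y + energy G y
        ≡⟨ cong (energy G y +_) (∑-comm (λ u v → edge-weight G u v * (y u * y v))) ⟩
      sum {n} (λ u → sum {n} λ v → edge-weight G u v * (y u * y v)) +
      sum {n} (λ u → sum {n} λ v → edge-weight G v u * (y v * y u))
        ≡⟨ ∑-distrib-+ (λ u → sum {n} λ v → edge-weight G u v * (y u * y v)) (λ u → sum {n} λ v → edge-weight G v u * (y v * y u)) ⟨
      sum {n} (λ u → sum {n} (λ v → edge-weight G u v * (y u * y v)) + sum {n} (λ v → edge-weight G v u * (y v * y u)))
        ≡⟨ (sum-cong-≋ λ u → sym (∑-distrib-+ (λ v → edge-weight G u v * (y u * y v)) (λ v → edge-weight G v u * (y v * y u)))) ⟩
      sum {n} (λ u → sum {n} λ v → edge-weight G u v * (y u * y v) + edge-weight G v u * (y v * y u))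
        ≡⟨ (sum-cong-≋ λ u → sum-cong-≋ λ v → term u v) ⟩
      sum {n} (λ u → sum {n} λ v → ι (A u v ℤ.* (X u ℤ.* X v)))
        ≡⟨ (sum-cong-≋ λ u → sym (ι-sum λ v → A u v ℤ.* (X u ℤ.* X v))) ⟩
      sum {n} (λ u → ι (∑ℤ.sum {n} λ v → A u v ℤ.* (X u ℤ.* X v)))
        ≡⟨ ι-sum (λ u → ∑ℤ.sum {n} λ v → A u v ℤ.* (X u ℤ.* X v)) ⟨
      ι (∑ℤ.form A X X) ∎
      where
      open ≡-Reasoning
      y = ι ∘ X
      term : ∀ u v → edge-weight G u v * (y u * y v) + edge-weight G v u * (y v * y u) ≡ ι (A u v ℤ.* (X u ℤ.* X v))
      term u v = begin
        edge-weight G u v * (y u * y v) + edge-weight G v u * (y v * y u)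
          ≡⟨ solve 4 (λ a b x y → a :* (x :* y) :+ b :* (y :* x) := (a :+ b) :* (x :* y)) refl
               (edge-weight G u v) (edge-weight G v u) (y u) (y v) ⟩
        (edge-weight G u v + edge-weight G v u) * (y u * y v)
          ≡⟨ cong₂ _*_ (⟦⟧+⟦⟧ u v) (sym (ι-* (X u) (X v))) ⟩
        ι (A u v) * ι (X u ℤ.* X v)
          ≡⟨ ι-* (A u v) (X u ℤ.* X v) ⟨
        ι (A u v ℤ.* (X u ℤ.* X v)) ∎

    integralHalf⇒β≤1/50 : .{{_ : NonZero n}} → IntegralHalf →
      ∃[ b ] (b Isβ G × b ℝ.≤ fromℚ (ℤ.+ 1 / 50))
    integralHalf⇒β≤1/50 H = β-exists-below G x₀ (box , sum-x₀) x₀-sparse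
      where
      open IntegralHalf H renaming (denominator to d; weight to X)
      D r : ℚ
      D = ι (ℤ.+ d)
      r = ℤ.+ 1 / d

      r*D : r * D ≡ 1ℚ
      r*D = /*ι (ℤ.+ 1) d

      0≤r : 0ℚ ≤ r
      0≤r = ℚ.nonNegative⁻¹ r {{ℚ.normalize-nonNeg 1 d}}

      x₀ : Vector ℚ n
      x₀ v = r * ι (X v)

      box : InBox x₀
      box v = 0≤* 0≤r (ι-mono (nonneg v)) , subst (x₀ v ≤_) r*D
        (ℚ.*-monoˡ-≤-nonNeg r {{nonNegative 0≤r}} (ι-mono (bounded v)))

      ν = ι (ℤ.+ n)

      sum-x₀ : sum x₀ ≡ ℤ.+ n / 2
      sum-x₀ = begin
        sum x₀                                   ≡⟨ ∑ℚ.∑-*ˡ r (ι ∘ X) ⟩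
        r * sum (ι ∘ X)                          ≡⟨ cong (r *_) (ι-sum X) ⟨
        r * ι (∑ℤ.sum X)                         ≡⟨ solve 2 (λ r s → r :* s := r :* (con (ι (ℤ.+ 2)) :* s) :* con ½) refl r (ι (∑ℤ.sum X)) ⟩
        r * (ι (ℤ.+ 2) * ι (∑ℤ.sum X)) * ½       ≡⟨ cong (λ a → r * a * ½) (ι-* (ℤ.+ 2) (∑ℤ.sum X)) ⟨
        r * ι (ℤ.+ 2 ℤ.* ∑ℤ.sum X) * ½           ≡⟨ cong (λ a → r * ι a * ½) total ⟩
        r * ι (ℤ.+ n ℤ.* ℤ.+ d) * ½              ≡⟨ cong (λ a → r * a * ½) (ι-* (ℤ.+ n) (ℤ.+ d)) ⟩
        r * (ν * D) * ½                          ≡⟨ solve 3 (λ r v d → r :* (v :* d) :* con ½ := (r :* d) :* v :* con ½) refl r ν D ⟩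
        (r * D) * ν * ½                          ≡⟨ cong (λ a → a * ν * ½) r*D ⟩
        1ℚ * ν * ½                               ≡⟨ cong (λ a → 1ℚ * a * ½) (/*ι (ℤ.+ n) 2) ⟨
        1ℚ * ((ℤ.+ n / 2) * ι (ℤ.+ 2)) * ½       ≡⟨ solve 1 (λ h → con 1ℚ :* (h :* con (ι (ℤ.+ 2))) :* con ½ := h) refl (ℤ.+ n / 2) ⟩
        ℤ.+ n / 2                                ∎
        where open ≡-Reasoning

      κ = n⁻² n

      x₀-sparse : κ * energy G x₀ ≤ ℤ.+ 1 / 50
      x₀-sparse = begin
        κ * energy G x₀
          ≡⟨ cong (κ *_) (energy-scale G r (ι ∘ X)) ⟩
        κ * (r * r * E)
          ≡⟨ solve 3 (λ k r e → k :* (r :* r :* e) := con (ℤ.+ 1 / 50) :* ((k :* (r :* r)) :* (con (ι (ℤ.+ 25)) :* (e :+ e)))) refl κ r E ⟩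
        (ℤ.+ 1 / 50) * ((κ * (r * r)) * (ι (ℤ.+ 25) * (E + E)))
          ≡⟨ cong (λ a → (ℤ.+ 1 / 50) * ((κ * (r * r)) * a)) (trans (cong (ι (ℤ.+ 25) *_) (energy-ι X)) (sym (ι-* (ℤ.+ 25) (∑ℤ.form A X X)))) ⟩
        (ℤ.+ 1 / 50) * ((κ * (r * r)) * ι (ℤ.+ 25 ℤ.* ∑ℤ.form A X X))
          ≤⟨ ℚ.*-monoˡ-≤-nonNeg (ℤ.+ 1 / 50) (ℚ.*-monoˡ-≤-nonNeg (κ * (r * r)) {{nonNegative (0≤* (0≤n⁻² n) (0≤* 0≤r 0≤r))}} (ι-mono sparse)) ⟩
        (ℤ.+ 1 / 50) * ((κ * (r * r)) * ι ((ℤ.+ n ℤ.* ℤ.+ n) ℤ.* (ℤ.+ d ℤ.* ℤ.+ d)))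
          ≡⟨ cong (λ a → (ℤ.+ 1 / 50) * ((κ * (r * r)) * a)) (trans (ι-* (ℤ.+ n ℤ.* ℤ.+ n) (ℤ.+ d ℤ.* ℤ.+ d))
               (cong (ι (ℤ.+ n ℤ.* ℤ.+ n) *_) (ι-* (ℤ.+ d) (ℤ.+ d)))) ⟩
        (ℤ.+ 1 / 50) * ((κ * (r * r)) * (ι (ℤ.+ n ℤ.* ℤ.+ n) * (D * D)))
          ≡⟨ solve 4 (λ k r v d → con (ℤ.+ 1 / 50) :* ((k :* (r :* r)) :* (v :* (d :* d))) := con (ℤ.+ 1 / 50) :* ((k :* v) :* ((r :* d) :* (r :* d)))) refl κ r (ι (ℤ.+ n ℤ.* ℤ.+ n)) D ⟩
        (ℤ.+ 1 / 50) * ((κ * ι (ℤ.+ n ℤ.* ℤ.+ n)) * ((r * D) * (r * D)))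
          ≡⟨ cong₂ (λ a b → (ℤ.+ 1 / 50) * (a * (b * b))) (n⁻²*n² n) r*D ⟩
        ℤ.+ 1 / 50 ∎
        where
        open ℚ.≤-Reasoning
        E = energy G (ι ∘ X)

-- Strongly regular identities and edge counts around a path of length two.

module TwoPaths where

  open LinearAlgebra
  open IntegralHalves using (module ∑ℤ; A; IntegralHalf)
  open import Defs using (Graph; adj; irreflexive; symmetric; neighbours; TriangleFree)
  open import Data.Bool using (Bool; true; false)
  open import Data.Fin as Fin using (Fin; zero; suc)
  import Data.Fin.Properties as Fin
  open import Data.Fin.Subset using (∣_∣; _∩_)
  open import Data.Integer hiding (suc; ∣_∣)
  import Data.Integer.Properties as ℤ
  open import Data.Integer.Tactic.RingSolver using (solve-∀)
  open import Data.Nat as ℕ using (ℕ)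
  open import Data.Product using (_×_; _,_; ∃-syntax)
  open import Data.Sum using (_⊎_; inj₁; inj₂)
  open import Data.Vec using (tabulate)
  open import Data.Vec.Functional using (Vector)
  open import Function using (_∘_)
  open import Relation.Binary.PropositionalEquality
  open import Relation.Nullary using (yes; no; contradiction)
  open ∑ℤ

  ∣tabulate∣ : ∀ {n} (f : Fin n → Bool) → + ∣ tabulate f ∣ ≡ sum (λ v → ⟦ f v ⟧)
  ∣tabulate∣ {ℕ.zero}  f = refl
  ∣tabulate∣ {ℕ.suc n} f with f zero
  ... | true  = cong (_+_ (+ 1)) (∣tabulate∣ (f ∘ suc))
  ... | false = trans (∣tabulate∣ (f ∘ suc)) (sym (ℤ.+-identityˡ _))

  ∣tabulate∩tabulate∣ : ∀ {n} (f g : Fin n → Bool) →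
    + ∣ tabulate f ∩ tabulate g ∣ ≡ sum (λ v → ⟦ f v ⟧ * ⟦ g v ⟧)
  ∣tabulate∩tabulate∣ {ℕ.zero}  f g = refl
  ∣tabulate∩tabulate∣ {ℕ.suc n} f g with f zero | g zero
  ... | true  | true  = cong (_+_ (+ 1)) (∣tabulate∩tabulate∣ (f ∘ suc) (g ∘ suc))
  ... | true  | false = trans (∣tabulate∩tabulate∣ (f ∘ suc) (g ∘ suc)) (sym (ℤ.+-identityˡ _))
  ... | false | true  = trans (∣tabulate∩tabulate∣ (f ∘ suc) (g ∘ suc)) (sym (ℤ.+-identityˡ _))
  ... | false | false = trans (∣tabulate∩tabulate∣ (f ∘ suc) (g ∘ suc)) (sym (ℤ.+-identityˡ _))

  -- Weights, over a common denominator, on u, v, w and on the sets U′ and ρ of TwoPath below.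
  record Weights : Set where
    constructor weights
    field
      denominator on-u on-v on-w on-U′ on-ρ : ℕ

  module _ (N K C : ℤ) where
    -- The size of R by inclusion-exclusion, with N(u) and N(w) as the only overlapping pair, and
    -- twice the number of edges inside R. A vertex of R has C neighbours in each of N(u), N(v),
    -- N(w), hence K - 3C neighbours in R plus those counted twice, in N(u) ∩ N(w). The latter add
    -- up to KC - K + C - C², the number of edges between N(u) ∩ N(w) and R.
    ∣ρ∣ 2e[ρ] : ℤ
    ∣ρ∣   = N - + 3 * K + C
    2e[ρ] = (K - + 3 * C) * ∣ρ∣ + K * C - K + C - C * C

    -- The edges inside the support are uv, vw, those from u to all of U′, those between U′ and R,
    -- and those inside R. A vertex of U′ has no neighbour in N(u) and C in each of N(v) and N(w),
    -- which leaves K - 2C in R.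
    totalWeight edgeWeight×2 : ℤ → ℤ → ℤ → ℤ → ℤ → ℤ
    totalWeight xu xv xw xU xρ = xu + xv + xw + xU * (K - C) + xρ * ∣ρ∣
    edgeWeight×2 xu xv xw xU xρ =
      + 2 * xv * (xu + xw) + + 2 * xu * xU * (K - C) +
      + 2 * xU * xρ * ((K - + 2 * C) * (K - C)) + xρ * xρ * 2e[ρ]

  -- Natural weights make nonnegativity automatic, while total and density are compared in ℤ because
  -- the counts contain differences.
  Admissible : ℕ → ℕ → ℕ → Weights → Set
  Admissible n k c (weights d xu xv xw xU xρ) =
    0 ℕ.< d × (xu ℕ.≤ d × xv ℕ.≤ d × xw ℕ.≤ d × xU ℕ.≤ d × xρ ℕ.≤ d) ×
    + 2 * totalWeight (+ n) (+ k) (+ c) (+ xu) (+ xv) (+ xw) (+ xU) (+ xρ) ≡ + n * + d ×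
    + 25 * edgeWeight×2 (+ n) (+ k) (+ c) (+ xu) (+ xv) (+ xw) (+ xU) (+ xρ) ≤ (+ n * + n) * (+ d * + d)

  module StronglyRegular {n : ℕ} (G : Graph n) (triangleFree : TriangleFree G)
    (k : ℕ) (regular : ∀ v → ∣ neighbours G v ∣ ≡ k)
    (c : ℕ) (common : ∀ v w → v ≢ w → adj G v w ≡ false →
      ∣ neighbours G v ∩ neighbours G w ∣ ≡ c) where

    N K C : ℤ
    N = + n
    K = + k
    C = + c

    a : Fin n → Vector ℤ n
    a = A G

    one : Vector ℤ n
    one _ = + 1

    infix 8 _∙_
    _∙_ : Vector ℤ n → Vector ℤ n → ℤ
    f ∙ g = sum (λ v → f v * g v)

    formA : Vector ℤ n → Vector ℤ n → ℤ
    formA = form a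

    a-sym : ∀ u v → a u v ≡ a v u
    a-sym u v = cong ⟦_⟧ (symmetric G u v)

    adjacent : ∀ {u v} → adj G u v ≡ true → a u v ≡ + 1
    adjacent = cong ⟦_⟧

    nonadjacent : ∀ {u v} → adj G u v ≡ false → a u v ≡ + 0
    nonadjacent = cong ⟦_⟧

    loopless : ∀ u → a u u ≡ + 0
    loopless u = nonadjacent (irreflexive G u)

    degree : ∀ u → sum (a u) ≡ K
    degree u = trans (sym (∣tabulate∣ (adj G u))) (cong +_ (regular u))

    sum-one : sum one ≡ N
    sum-one = lemma n
      where
      lemma : ∀ m → sum {m} (λ _ → + 1) ≡ + m
      lemma ℕ.zero    = refl
      lemma (ℕ.suc m) = cong (_+_ (+ 1)) (lemma m)

    -- Triangle-freeness as an equation, ready for use under sums.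
    no-triangle : ∀ u v w → a u v * (a v w * a u w) ≡ + 0
    no-triangle u v w with adj G u v in uv | adj G v w in vw | adj G u w in uw
    ... | true  | true  | true  = contradiction (uv , vw , uw) (triangleFree u v w)
    ... | true  | true  | false = refl
    ... | true  | false | true  = refl
    ... | true  | false | false = refl
    ... | false | _     | _     = refl

    -- The entries of A². The three cases are the degree, the common neighbours of a nonadjacent
    -- pair, and an edge, whose ends have no common neighbour.
    square : ∀ u v → a u ∙ a v ≡ (K - C) * unit u v + C * (+ 1 - a u v)
    square u v with u Fin.≟ v
    ... | yes refl = begin
      a u ∙ a u                                      ≡⟨ (sum-cong-≋ λ x → idempotent (adj G u x)) ⟩
      sum (a u)                                      ≡⟨ degree u ⟩
      K                                              ≡⟨ algebra K C ⟩
      (K - C) * + 1 + C * (+ 1 - + 0)                ≡⟨ cong (λ b → (K - C) * + 1 + C * (+ 1 - b)) (loopless u) ⟨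
      (K - C) * + 1 + C * (+ 1 - a u u)              ∎
      where
      open ≡-Reasoning
      idempotent : ∀ b → ⟦ b ⟧ * ⟦ b ⟧ ≡ ⟦ b ⟧
      idempotent true  = refl
      idempotent false = refl
      algebra : ∀ K C → K ≡ (K - C) * + 1 + C * (+ 1 - + 0)
      algebra = solve-∀
    ... | no u≢v with adj G u v in uv
    ...   | false = trans (sym (∣tabulate∩tabulate∣ (adj G u) (adj G v)))
            (trans (cong +_ (common u v u≢v uv)) (algebra K C))
      where
      algebra : ∀ K C → C ≡ (K - C) * + 0 + C * (+ 1 - + 0)
      algebra = solve-∀
    ...   | true  = trans (trans (sum-cong-≋ λ x → term x) (sum-replicate-zero n)) (algebra K C)
      where
      term : ∀ x → a u x * a v x ≡ + 0
      term x = trans (sym (ℤ.*-identityˡ _)) (trans (cong₂ (λ p q → p * (a u x * q)) (sym (adjacent uv)) (a-sym v x))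
        (trans (cong (a u v *_) (ℤ.*-comm (a u x) (a x v)))
        (trans (cong (λ q → a u v * (q * a u x)) (a-sym x v)) (no-triangle u v x))))
      algebra : ∀ K C → + 0 ≡ (K - C) * + 0 + C * (+ 1 - + 1)
      algebra = solve-∀

    -- The inner product is the form of the identity matrix, which makes the Gram expansion
    -- available for it.
    ∙≡form : ∀ f g → f ∙ g ≡ form unit f g
    ∙≡form f g = sum-cong-≋ λ u → sym (begin
      sum (λ v → unit u v * (f u * g v))   ≡⟨ ∑-unit u (λ v → f u * g v) ⟩
      f u * g u                            ∎)
      where open ≡-Reasoning

    sum-of-squares : ∀ f → + 0 ≤ f ∙ f
    sum-of-squares f = lemma (λ v → f v * f v) (λ v → square≥0 (f v))
      where
      square≥0 : ∀ i → + 0 ≤ i * i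
      square≥0 (+ m)      = subst (+ 0 ≤_) (ℤ.pos-* m m) (+≤+ ℕ.z≤n)
      square≥0 (-[1+ m ]) = +≤+ ℕ.z≤n
      lemma : ∀ {m} (g : Vector ℤ m) → (∀ v → + 0 ≤ g v) → + 0 ≤ sum g
      lemma {ℕ.zero}  g g≥0 = ℤ.≤-refl
      lemma {ℕ.suc m} g g≥0 = ℤ.+-mono-≤ (g≥0 zero) (lemma (g ∘ suc) (g≥0 ∘ suc))

    ∙-comm : ∀ f g → f ∙ g ≡ g ∙ f
    ∙-comm f g = sum-cong-≋ λ v → ℤ.*-comm (f v) (g v)

    ∙-one : ∀ f → f ∙ one ≡ sum f
    ∙-one f = sum-cong-≋ λ v → ℤ.*-identityʳ (f v)

    sum-zero : ∀ {f : Vector ℤ n} → (∀ v → f v ≡ + 0) → sum f ≡ + 0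
    sum-zero f≡0 = trans (sum-cong-≋ f≡0) (sum-replicate-zero n)

    formA-sym : ∀ f g → formA f g ≡ formA g f
    formA-sym f g = trans (∑-comm (λ u v → a u v * (f u * g v)))
      (sum-cong-≋ λ v → sum-cong-≋ λ u → cong₂ _*_ (a-sym u v) (ℤ.*-comm (f u) (g v)))

    formA-zero : ∀ f g → (∀ u v → a u v * (f u * g v) ≡ + 0) → formA f g ≡ + 0
    formA-zero f g h = sum-zero λ u → sum-zero (h u)

    infix 9 A·_
    A·_ : Vector ℤ n → Vector ℤ n
    (A· f) x = a x ∙ f

    formA-A· : ∀ f g → formA f g ≡ f ∙ (A· g)
    formA-A· f g = sum-cong-≋ λ u → trans
      (sum-cong-≋ λ v → rearrange (a u v) (f u) (g v))
      (∑-*ˡ (f u) (λ v → a u v * g v))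
      where
      rearrange : ∀ a f g → a * (f * g) ≡ f * (a * g)
      rearrange = solve-∀

    formA-unitˡ : ∀ p g → formA (unit p) g ≡ a p ∙ g
    formA-unitˡ p g = trans (formA-A· (unit p) g) (∑-unit p (A· g))

    A·one : ∀ x → (A· one) x ≡ K
    A·one x = trans (∙-one (a x)) (degree x)

    formA-oneʳ : ∀ f → formA f one ≡ K * sum f
    formA-oneʳ f = begin
      formA f one                 ≡⟨ formA-A· f one ⟩
      sum (λ x → f x * (A· one) x)  ≡⟨ (sum-cong-≋ λ x → trans (cong (f x *_) (A·one x)) (ℤ.*-comm (f x) K)) ⟩
      sum (λ x → K * f x)         ≡⟨ ∑-*ˡ K f ⟩
      K * sum f                   ∎
      where open ≡-Reasoning

    A·neighbours : ∀ u x → (A· a u) x ≡ (K - C) * unit u x + C * (+ 1 - a u x)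
    A·neighbours u x = trans (∙-comm (a x) (a u)) (square u x)

    -- By `square`, A sends `a u` to a combination of `unit u`, `one` and `a u`. Pairing `f` with a
    -- neighbourhood thus needs only its value at `u`, its sum and its weight on the neighbourhood.
    formA-neighboursʳ : ∀ f u → formA f (a u) ≡ (K - C) * f u + C * (sum f - a u ∙ f)
    formA-neighboursʳ f u = begin
      formA f (a u)
        ≡⟨ formA-A· f (a u) ⟩
      sum (λ x → f x * (A· a u) x)
        ≡⟨ (sum-cong-≋ λ x → trans (cong (f x *_) (A·neighbours u x)) (expand (f x) (K - C) C (unit u x) (a u x))) ⟩
      sum (λ x → (K - C) * (unit u x * f x) + (C * f x + (- C) * (a u x * f x)))
        ≡⟨ ∑-distrib-+ (λ x → (K - C) * (unit u x * f x)) _ ⟩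
      sum (λ x → (K - C) * (unit u x * f x)) + sum (λ x → C * f x + (- C) * (a u x * f x))
        ≡⟨ cong₂ _+_ (trans (∑-*ˡ (K - C) (λ x → unit u x * f x)) (cong ((K - C) *_) (∑-unit u f)))
             (trans (∑-distrib-+ (λ x → C * f x) _) (cong₂ _+_ (∑-*ˡ C f) (∑-*ˡ (- C) (λ x → a u x * f x)))) ⟩
      (K - C) * f u + (C * sum f + (- C) * (a u ∙ f))
        ≡⟨ collect ((K - C) * f u) C (sum f) (a u ∙ f) ⟩
      (K - C) * f u + C * (sum f - a u ∙ f) ∎
      where
      open ≡-Reasoning
      expand : ∀ f d c e a → f * (d * e + c * (+ 1 - a)) ≡ d * (e * f) + (c * f + (- c) * (a * f))
      expand = solve-∀
      collect : ∀ p c s t → p + (c * s + (- c) * t) ≡ p + c * (s - t)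
      collect = solve-∀

    disjoint : ∀ {p q} → adj G p q ≡ true → ∀ x → a p x * a q x ≡ + 0
    disjoint {p} {q} p~q x = begin
      a p x * a q x                    ≡⟨ ℤ.*-identityˡ _ ⟨
      + 1 * (a p x * a q x)            ≡⟨ cong₂ (λ i j → i * j) (sym (adjacent p~q)) (ℤ.*-comm (a p x) (a q x)) ⟩
      a p q * (a q x * a p x)          ≡⟨ no-triangle p q x ⟩
      + 0                              ∎
      where open ≡-Reasoning

    -- Neighbourhoods are independent sets. Support in N(p) is expressed by a factor `a p`, which
    -- suits the product form of `no-triangle`.
    inside : ∀ p {f g : Vector ℤ n} (f′ g′ : Vector ℤ n) →
      (∀ x → f x ≡ a p x * f′ x) → (∀ x → g x ≡ a p x * g′ x) → formA f g ≡ + 0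
    inside p {f} {g} f′ g′ f≡ g≡ = formA-zero f g λ x y →
      trans (cong₂ (λ i j → a x y * (i * j)) (f≡ x) (g≡ y))
      (trans (rearrange (a x y) (a p x) (f′ x) (a p y) (g′ y))
      (trans (cong (_* (f′ x * g′ y)) (no-triangle p x y)) (ℤ.*-zeroˡ (f′ x * g′ y))))
      where
      rearrange : ∀ e i f j g → e * (i * f * (j * g)) ≡ (i * (e * j)) * (f * g)
      rearrange = solve-∀

    -- The walks of length two from `u`, counted once by degrees and once through `square`.
    order-equation : Fin n → K * K ≡ (K - C) + C * (N - K)
    order-equation u = begin
      K * K                                         ≡⟨ cong (K *_) (degree u) ⟨
      K * sum (a u)                                 ≡⟨ formA-oneʳ (a u) ⟨
      formA (a u) one                               ≡⟨ formA-sym (a u) one ⟩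
      formA one (a u)                               ≡⟨ formA-neighboursʳ one u ⟩
      (K - C) * + 1 + C * (sum one - a u ∙ one)     ≡⟨ cong₂ (λ s t → (K - C) * + 1 + C * (s - t)) sum-one (A·one u) ⟩
      (K - C) * + 1 + C * (N - K)                   ≡⟨ cong (_+ C * (N - K)) (ℤ.*-identityʳ (K - C)) ⟩
      (K - C) + C * (N - K)                         ∎
      where open ≡-Reasoning

    module TwoPath (u v w : Fin n) (v~u : adj G v u ≡ true) (v~w : adj G v w ≡ true) (u≢w : u ≢ w) where

      u~v : adj G u v ≡ true
      u~v = trans (symmetric G u v) v~u

      w~v : adj G w v ≡ true
      w~v = trans (symmetric G w v) v~w

      u≁w : adj G u w ≡ false
      u≁w with adj G u w in uw
      ... | true  = contradiction (v~u , uw , v~w) (triangleFree v u w)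
      ... | false = refl

      w≁u : adj G w u ≡ false
      w≁u = trans (symmetric G w u) u≁w

      u≢v : u ≢ v
      u≢v refl with trans (sym u~v) (irreflexive G u)
      ... | ()

      w≢v : w ≢ v
      w≢v refl with trans (sym w~v) (irreflexive G w)
      ... | ()

      -- Indicators of N(u) ∩ N(w), of N(u) without N(w), and of R. The vertex `v` lies in the first
      -- set; R contains none of `u`, `v`, `w`, since each of them lies in one of the removed
      -- neighbourhoods.
      Z U′ ρ : Vector ℤ n
      Z x  = a u x * a w x
      U′ x = a u x * (+ 1 - a w x)
      ρ x  = (+ 1 - a u x) * ((+ 1 - a v x) * (+ 1 - a w x))

      sum-Z : sum Z ≡ C
      sum-Z = begin
        a u ∙ a w                                       ≡⟨ square u w ⟩
        (K - C) * unit u w + C * (+ 1 - a u w)          ≡⟨ cong₂ (λ i j → (K - C) * i + C * (+ 1 - j)) (unit-other u≢w) (nonadjacent u≁w) ⟩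
        (K - C) * + 0 + C * (+ 1 - + 0)                 ≡⟨ algebra K C ⟩
        C                                               ∎
        where
        open ≡-Reasoning
        algebra : ∀ K C → (K - C) * + 0 + C * (+ 1 - + 0) ≡ C
        algebra = solve-∀

      private
        complement-zero : ∀ p x → a p x * (+ 1 - a p x) ≡ + 0
        complement-zero p x with adj G p x
        ... | true  = refl
        ... | false = refl

        U′-expand : ∀ x → U′ x ≡ a u x + (- + 1) * Z x
        U′-expand x = algebra (a u x) (a w x)
          where
          algebra : ∀ p q → p * (+ 1 - q) ≡ p + (- + 1) * (p * q)
          algebra = solve-∀

        ρ-parts : Fin 5 → Vector ℤ n
        ρ-parts zero                         = one
        ρ-parts (suc zero)                   = a u
        ρ-parts (suc (suc zero))             = a v
        ρ-parts (suc (suc (suc zero)))       = a w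
        ρ-parts (suc (suc (suc (suc zero)))) = Z

        ρ-signs : Vector ℤ 5
        ρ-signs zero                         = + 1
        ρ-signs (suc zero)                   = - + 1
        ρ-signs (suc (suc zero))             = - + 1
        ρ-signs (suc (suc (suc zero)))       = - + 1
        ρ-signs (suc (suc (suc (suc zero)))) = + 1

        -- Inclusion-exclusion: `v` is adjacent to `u` and `w`, so N(v) is disjoint from N(u) and
        -- N(w), and `Z` is the only overlap left.
        ρ-expand : ∀ x → ρ x ≡ combination ρ-signs ρ-parts x
        ρ-expand x = trans
          (algebra (a u x) (a v x) (a w x))
          (trans
            (cong₂ (λ i j → combination ρ-signs ρ-parts x + (i * (+ 1 - a w x) + j)) (disjoint u~v x) (disjoint v~w x))
            (ℤ.+-identityʳ (combination ρ-signs ρ-parts x)))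
          where
          algebra : ∀ p q r → (+ 1 - p) * ((+ 1 - q) * (+ 1 - r)) ≡
            (+ 1 * + 1 + ((- + 1) * p + ((- + 1) * q + ((- + 1) * r + (+ 1 * (p * r) + + 0))))) +
            ((p * q) * (+ 1 - r) + q * r)
          algebra = solve-∀

      sum-U′ : sum U′ ≡ K - C
      sum-U′ = begin
        sum U′                              ≡⟨ sum-cong-≋ U′-expand ⟩
        sum (λ x → a u x + (- + 1) * Z x)   ≡⟨ ∑-distrib-+ (a u) (λ x → (- + 1) * Z x) ⟩
        sum (a u) + sum (λ x → (- + 1) * Z x) ≡⟨ cong₂ _+_ (degree u) (trans (∑-*ˡ (- + 1) Z) (cong ((- + 1) *_) sum-Z)) ⟩
        K + (- + 1) * C                     ≡⟨ algebra K C ⟩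
        K - C                               ∎
        where
        open ≡-Reasoning
        algebra : ∀ K C → K + (- + 1) * C ≡ K - C
        algebra = solve-∀

      sum-ρ : sum ρ ≡ ∣ρ∣ N K C
      sum-ρ = begin
        sum ρ                                          ≡⟨ sum-cong-≋ ρ-expand ⟩
        sum (combination ρ-signs ρ-parts)              ≡⟨ sum-combination ρ-signs ρ-parts ⟩
        sum (λ i → ρ-signs i * sum (ρ-parts i))        ≡⟨ (sum-cong-≋ λ i → cong (ρ-signs i *_) (sums i)) ⟩
        sum (λ i → ρ-signs i * size i)                 ≡⟨ algebra N K C ⟩
        ∣ρ∣ N K C                                      ∎
        where
        open ≡-Reasoning
        size : Vector ℤ 5
        size zero                         = N
        size (suc zero)                   = K
        size (suc (suc zero))             = K
        size (suc (suc (suc zero)))       = K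
        size (suc (suc (suc (suc zero)))) = C
        sums : ∀ i → sum (ρ-parts i) ≡ size i
        sums zero                         = sum-one
        sums (suc zero)                   = degree u
        sums (suc (suc zero))             = degree v
        sums (suc (suc (suc zero)))       = degree w
        sums (suc (suc (suc (suc zero)))) = sum-Z
        algebra : ∀ N K C → + 1 * N + ((- + 1) * K + ((- + 1) * K + ((- + 1) * K + (+ 1 * C + + 0)))) ≡ N - + 3 * K + C
        algebra = solve-∀

      private
        formA-ρʳ : ∀ g {g∙u g∙v g∙w g∙Z} → formA g (a u) ≡ g∙u → formA g (a v) ≡ g∙v →
          formA g (a w) ≡ g∙w → formA g Z ≡ g∙Z →
          formA g ρ ≡ K * sum g - g∙u - g∙v - g∙w + g∙Z
        formA-ρʳ g refl refl refl refl = begin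
          formA g ρ                                            ≡⟨ form-cong a {x = g} (λ _ → refl) ρ-expand ⟩
          formA g (combination ρ-signs ρ-parts)                ≡⟨ form-combinationʳ a g ρ-signs ρ-parts ⟩
          sum (λ i → ρ-signs i * formA g (ρ-parts i))          ≡⟨ algebra (formA g one) (formA g (a u)) (formA g (a v)) (formA g (a w)) (formA g Z) ⟩
          formA g one - formA g (a u) - formA g (a v) - formA g (a w) + formA g Z
            ≡⟨ cong (λ o → o - formA g (a u) - formA g (a v) - formA g (a w) + formA g Z) (formA-oneʳ g) ⟩
          K * sum g - formA g (a u) - formA g (a v) - formA g (a w) + formA g Z ∎
          where
          open ≡-Reasoning
          algebra : ∀ o p q r z → + 1 * o + ((- + 1) * p + ((- + 1) * q + ((- + 1) * r + (+ 1 * z + + 0)))) ≡ o - p - q - r + z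
          algebra = solve-∀

        -- A vertex that is neither `p` nor adjacent to `p` has `C` neighbours in N(p). The two
        -- hypotheses remove the contributions of `p` and of N(p).
        formA-farʳ : ∀ f p → f p ≡ + 0 → a p ∙ f ≡ + 0 → formA f (a p) ≡ C * sum f
        formA-farʳ f p f-p far = trans (formA-neighboursʳ f p)
          (trans (cong₂ (λ i j → (K - C) * i + C * (sum f - j)) f-p far) (algebra (K - C) C (sum f)))
          where
          algebra : ∀ d c s → d * + 0 + c * (s - + 0) ≡ c * s
          algebra = solve-∀

        avoids : ∀ p {f} (f′ : Vector ℤ n) → (∀ x → f x ≡ (+ 1 - a p x) * f′ x) → a p ∙ f ≡ + 0
        avoids p {f} f′ f≡ = sum-zero λ x → begin
          a p x * f x                          ≡⟨ cong (a p x *_) (f≡ x) ⟩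
          a p x * ((+ 1 - a p x) * f′ x)       ≡⟨ ℤ.*-assoc (a p x) (+ 1 - a p x) (f′ x) ⟨
          a p x * (+ 1 - a p x) * f′ x         ≡⟨ cong (_* f′ x) (complement-zero p x) ⟩
          + 0 * f′ x                           ≡⟨ ℤ.*-zeroˡ (f′ x) ⟩
          + 0                                  ∎
          where open ≡-Reasoning

        ρ-avoids-u : a u ∙ ρ ≡ + 0
        ρ-avoids-u = avoids u (λ x → (+ 1 - a v x) * (+ 1 - a w x)) (λ _ → refl)

        ρ-avoids-v : a v ∙ ρ ≡ + 0
        ρ-avoids-v = avoids v (λ x → (+ 1 - a u x) * (+ 1 - a w x)) (λ x → rearrange (+ 1 - a u x) (+ 1 - a v x) (+ 1 - a w x))
          where
          rearrange : ∀ p q r → p * (q * r) ≡ q * (p * r)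
          rearrange = solve-∀

        ρ-avoids-w : a w ∙ ρ ≡ + 0
        ρ-avoids-w = avoids w (λ x → (+ 1 - a u x) * (+ 1 - a v x)) (λ x → rearrange (+ 1 - a u x) (+ 1 - a v x) (+ 1 - a w x))
          where
          rearrange : ∀ p q r → p * (q * r) ≡ r * (p * q)
          rearrange = solve-∀

        U′-avoids-w : a w ∙ U′ ≡ + 0
        U′-avoids-w = avoids w (a u) (λ x → ℤ.*-comm (a u x) (+ 1 - a w x))

        U′-avoids-v : a v ∙ U′ ≡ + 0
        U′-avoids-v = sum-zero λ x → trans (sym (ℤ.*-assoc (a v x) (a u x) (+ 1 - a w x)))
          (trans (cong (_* (+ 1 - a w x)) (disjoint v~u x)) (ℤ.*-zeroˡ (+ 1 - a w x)))

        U′-of-u : a u ∙ U′ ≡ K - C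
        U′-of-u = trans (sum-cong-≋ λ x → absorb (adj G u x) (+ 1 - a w x)) sum-U′
          where
          absorb : ∀ b i → ⟦ b ⟧ * (⟦ b ⟧ * i) ≡ ⟦ b ⟧ * i
          absorb true  i = ℤ.*-identityˡ (+ 1 * i)
          absorb false i = refl

        Z-far-v : a v ∙ Z ≡ + 0
        Z-far-v = sum-zero λ x → trans (sym (ℤ.*-assoc (a v x) (a u x) (a w x)))
          (trans (cong (_* a w x) (disjoint v~u x)) (ℤ.*-zeroˡ (a w x)))

        Z-v : Z v ≡ + 1
        Z-v = cong₂ _*_ (adjacent u~v) (adjacent w~v)

        ρ-u : ρ u ≡ + 0
        ρ-u = trans (cong (λ i → (+ 1 - a u u) * ((+ 1 - i) * (+ 1 - a w u))) (adjacent v~u)) (ℤ.*-zeroʳ (+ 1 - a u u))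

        ρ-v : ρ v ≡ + 0
        ρ-v = cong (λ i → (+ 1 - i) * ((+ 1 - a v v) * (+ 1 - a w v))) (adjacent u~v)

        ρ-w : ρ w ≡ + 0
        ρ-w = trans (cong (λ i → (+ 1 - a u w) * ((+ 1 - i) * (+ 1 - a w w))) (adjacent v~w)) (ℤ.*-zeroʳ (+ 1 - a u w))

        U′-v : U′ v ≡ + 0
        U′-v = trans (cong (λ i → a u v * (+ 1 - i)) (adjacent w~v)) (ℤ.*-zeroʳ (a u v))

        U′-w : U′ w ≡ + 0
        U′-w = cong (_* (+ 1 - a w w)) (nonadjacent u≁w)

        formA-U′-U′ : formA U′ U′ ≡ + 0
        formA-U′-U′ = inside u (λ x → + 1 - a w x) (λ x → + 1 - a w x) (λ _ → refl) (λ _ → refl)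

        formA-U′-ρ : formA U′ ρ ≡ (K - + 2 * C) * (K - C)
        formA-U′-ρ = trans
          (formA-ρʳ U′
            (inside u (λ x → + 1 - a w x) one (λ _ → refl) (λ x → sym (ℤ.*-identityʳ (a u x))))
            (formA-farʳ U′ v U′-v U′-avoids-v) (formA-farʳ U′ w U′-w U′-avoids-w)
            (inside u (λ x → + 1 - a w x) (a w) (λ _ → refl) (λ _ → refl)))
          (trans (cong (λ s → K * s - + 0 - C * s - C * s + + 0) sum-U′) (algebra K C))
          where
          algebra : ∀ K C → K * (K - C) - + 0 - C * (K - C) - C * (K - C) + + 0 ≡ (K - + 2 * C) * (K - C)
          algebra = solve-∀

        -- The vertex `v` has all its neighbours in N(v) and contributes nothing. Each of the other
        -- C - 1 vertices of `Z` has K neighbours, none in N(u) or N(w) and C in N(v). This gives (C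
        -- - 1)(K - C).
        formA-Z-ρ : formA Z ρ ≡ K * C - K + C - C * C
        formA-Z-ρ = trans
          (formA-ρʳ Z
            (inside u (a w) one (λ _ → refl) (λ x → sym (ℤ.*-identityʳ (a u x))))
            (formA-neighboursʳ Z v)
            (inside w (a u) one (λ x → ℤ.*-comm (a u x) (a w x)) (λ x → sym (ℤ.*-identityʳ (a w x))))
            (inside u (a w) (a w) (λ _ → refl) (λ _ → refl)))
          (trans (cong₂ (λ s i → K * s - + 0 - ((K - C) * i + C * (s - a v ∙ Z)) - + 0 + + 0) sum-Z Z-v)
            (trans (cong (λ i → K * C - + 0 - ((K - C) * + 1 + C * (C - i)) - + 0 + + 0) Z-far-v) (algebra K C)))
          where
          algebra : ∀ K C → K * C - + 0 - ((K - C) * + 1 + C * (C - + 0)) - + 0 + + 0 ≡ K * C - K + C - C * C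
          algebra = solve-∀

        formA-ρ-ρ : formA ρ ρ ≡ 2e[ρ] N K C
        formA-ρ-ρ = trans
          (formA-ρʳ ρ (formA-farʳ ρ u ρ-u ρ-avoids-u) (formA-farʳ ρ v ρ-v ρ-avoids-v)
            (formA-farʳ ρ w ρ-w ρ-avoids-w) (trans (formA-sym ρ Z) formA-Z-ρ))
          (trans (cong (λ s → K * s - C * s - C * s - C * s + (K * C - K + C - C * C)) sum-ρ) (algebra (∣ρ∣ N K C) K C))
          where
          algebra : ∀ r K C → K * r - C * r - C * r - C * r + (K * C - K + C - C * C) ≡
            (K - + 3 * C) * r + K * C - K + C - C * C
          algebra = solve-∀

      private
        -- `t x` counts the common neighbours of `x`, `u` and `w`. Triangle-freeness confines its
        -- support to `far`, the complement of N(u) ∪ N(w), which contains `u` and `w`.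
        t far : Vector ℤ n
        t   = A· Z
        far x = (+ 1 - a u x) * (+ 1 - a w x)

        Z∙Z : Z ∙ Z ≡ C
        Z∙Z = trans (sum-cong-≋ λ x → idempotent (adj G u x) (adj G w x)) sum-Z
          where
          idempotent : ∀ p q → (⟦ p ⟧ * ⟦ q ⟧) * (⟦ p ⟧ * ⟦ q ⟧) ≡ ⟦ p ⟧ * ⟦ q ⟧
          idempotent true  true  = refl
          idempotent true  false = refl
          idempotent false q     = refl

        formA-Z-Z : formA Z Z ≡ + 0
        formA-Z-Z = inside u (a w) (a w) (λ _ → refl) (λ _ → refl)

        A·t : ∀ x → (A· t) x ≡ (K - C) * Z x + C * (C - t x)
        A·t x = begin
          a x ∙ t                                ≡⟨ formA-A· (a x) Z ⟨
          formA (a x) Z                          ≡⟨ formA-sym (a x) Z ⟩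
          formA Z (a x)                          ≡⟨ formA-neighboursʳ Z x ⟩
          (K - C) * Z x + C * (sum Z - t x)      ≡⟨ cong (λ i → (K - C) * Z x + C * (i - t x)) sum-Z ⟩
          (K - C) * Z x + C * (C - t x)          ∎
          where open ≡-Reasoning

        -- This is the form of A² at `Z`, evaluated by the strongly regular identity. The term with
        -- A itself vanishes because `Z` is independent.
        t∙t : t ∙ t ≡ (K - C) * C + C * (C * C)
        t∙t = begin
          t ∙ t
            ≡⟨ formA-A· t Z ⟨
          formA t Z
            ≡⟨ formA-sym t Z ⟩
          formA Z t
            ≡⟨ formA-A· Z t ⟩
          sum (λ x → Z x * (A· t) x)
            ≡⟨ (sum-cong-≋ λ x → trans (cong (Z x *_) (A·t x)) (expand (Z x) (K - C) C (t x))) ⟩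
          sum (λ x → (K - C) * (Z x * Z x) + ((C * C) * Z x + (- C) * (Z x * t x)))
            ≡⟨ ∑-distrib-+ (λ x → (K - C) * (Z x * Z x)) _ ⟩
          sum (λ x → (K - C) * (Z x * Z x)) + sum (λ x → (C * C) * Z x + (- C) * (Z x * t x))
            ≡⟨ cong₂ _+_ (∑-*ˡ (K - C) (λ x → Z x * Z x))
                 (trans (∑-distrib-+ (λ x → (C * C) * Z x) _) (cong₂ _+_ (∑-*ˡ (C * C) Z) (∑-*ˡ (- C) (λ x → Z x * t x)))) ⟩
          (K - C) * (Z ∙ Z) + ((C * C) * sum Z + (- C) * (Z ∙ t))
            ≡⟨ cong₂ (λ i j → (K - C) * i + j) Z∙Z
                 (cong₂ (λ i j → (C * C) * i + (- C) * j) sum-Z (trans (sym (formA-A· Z Z)) formA-Z-Z)) ⟩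
          (K - C) * C + ((C * C) * C + (- C) * + 0)
            ≡⟨ collect K C ⟩
          (K - C) * C + C * (C * C) ∎
          where
          open ≡-Reasoning
          expand : ∀ z d c t → z * (d * z + c * (c - t)) ≡ d * (z * z) + ((c * c) * z + (- c) * (z * t))
          expand = solve-∀
          collect : ∀ K C → (K - C) * C + ((C * C) * C + (- C) * + 0) ≡ (K - C) * C + C * (C * C)
          collect = solve-∀

        t-off : ∀ p (f′ : Vector ℤ n) → (∀ y → Z y ≡ a p y * f′ y) → ∀ x → t x * a p x ≡ + 0
        t-off p f′ Z≡ x = trans (sym (∑-*ʳ (a p x) (λ y → a x y * Z y))) (sum-zero λ y → begin
          a x y * Z y * a p x              ≡⟨ cong (λ i → a x y * i * a p x) (Z≡ y) ⟩
          a x y * (a p y * f′ y) * a p x   ≡⟨ rearrange (a x y) (a p y) (f′ y) (a p x) ⟩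
          (a p x * (a x y * a p y)) * f′ y ≡⟨ cong (_* f′ y) (no-triangle p x y) ⟩
          + 0 * f′ y                       ≡⟨ ℤ.*-zeroˡ (f′ y) ⟩
          + 0                              ∎)
          where
          open ≡-Reasoning
          rearrange : ∀ e i f j → e * (i * f) * j ≡ (j * (e * i)) * f
          rearrange = solve-∀

        t∙far : t ∙ far ≡ K * C
        t∙far = begin
          sum (λ x → t x * far x)   ≡⟨ (sum-cong-≋ λ x → trans (expand (t x) (a u x) (a w x))
                                       (trans (cong₂ (λ i j → t x + (i * (a w x - + 1) - j))
                                          (t-off u (a w) (λ _ → refl) x)
                                          (t-off w (a u) (λ y → ℤ.*-comm (a u y) (a w y)) x))
                                        (ℤ.+-identityʳ (t x)))) ⟩
          sum t                   ≡⟨ (sum-cong-≋ λ x → ℤ.*-identityˡ (t x)) ⟨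
          one ∙ t                 ≡⟨ formA-A· one Z ⟨
          formA one Z             ≡⟨ formA-sym one Z ⟩
          formA Z one             ≡⟨ formA-oneʳ Z ⟩
          K * sum Z               ≡⟨ cong (K *_) sum-Z ⟩
          K * C                   ∎
          where
          open ≡-Reasoning
          expand : ∀ t p q → t * ((+ 1 - p) * (+ 1 - q)) ≡ t + ((t * p) * (q - + 1) - t * q)
          expand = solve-∀

        t-u : t u ≡ C
        t-u = trans (sum-cong-≋ λ x → absorb (adj G u x) (a w x)) sum-Z
          where
          absorb : ∀ b i → ⟦ b ⟧ * (⟦ b ⟧ * i) ≡ ⟦ b ⟧ * i
          absorb true  i = ℤ.*-identityˡ (+ 1 * i)
          absorb false i = refl

        t-w : t w ≡ C
        t-w = trans (sum-cong-≋ λ x → absorb (adj G w x) (a u x)) sum-Z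
          where
          absorb : ∀ b i → ⟦ b ⟧ * (i * ⟦ b ⟧) ≡ i * ⟦ b ⟧
          absorb true  i = ℤ.*-identityˡ (i * + 1)
          absorb false i = sym (ℤ.*-zeroʳ i)

        far-u : far u ≡ + 1
        far-u = cong₂ (λ i j → (+ 1 - i) * (+ 1 - j)) (loopless u) (nonadjacent w≁u)

        far-w : far w ≡ + 1
        far-w = cong₂ (λ i j → (+ 1 - i) * (+ 1 - j)) (nonadjacent u≁w) (loopless w)

        far∙far : far ∙ far ≡ N - + 2 * K + C
        far∙far = begin
          sum (λ x → far x * far x)   ≡⟨ (sum-cong-≋ λ x → trans (idempotent (adj G u x) (adj G w x)) (expand (a u x) (a w x))) ⟩
          sum (λ x → + 1 + ((- + 1) * a u x + ((- + 1) * a w x + Z x)))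
            ≡⟨ trans (∑-distrib-+ one _) (cong (_+_ (sum one))
                 (trans (∑-distrib-+ (λ x → (- + 1) * a u x) _) (cong₂ _+_ (∑-*ˡ (- + 1) (a u))
                   (trans (∑-distrib-+ (λ x → (- + 1) * a w x) Z) (cong (_+ sum Z) (∑-*ˡ (- + 1) (a w))))))) ⟩
          sum one + ((- + 1) * sum (a u) + ((- + 1) * sum (a w) + sum Z))
            ≡⟨ cong₂ (λ i j → i + j) sum-one (cong₂ (λ i j → (- + 1) * i + j) (degree u)
                 (cong₂ (λ i j → (- + 1) * i + j) (degree w) sum-Z)) ⟩
          N + ((- + 1) * K + ((- + 1) * K + C))
            ≡⟨ collect N K C ⟩
          N - + 2 * K + C         ∎
          where
          open ≡-Reasoning
          idempotent : ∀ p q → let j = (+ 1 - ⟦ p ⟧) * (+ 1 - ⟦ q ⟧) in j * j ≡ j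
          idempotent true  q     = refl
          idempotent false true  = refl
          idempotent false false = refl
          expand : ∀ p q → (+ 1 - p) * (+ 1 - q) ≡ + 1 + ((- + 1) * p + ((- + 1) * q + p * q))
          expand = solve-∀
          collect : ∀ N K C → N + ((- + 1) * K + ((- + 1) * K + C)) ≡ N - + 2 * K + C
          collect = solve-∀

      -- Second moment of t = # common neighbours with u and w, over the r
      -- vertices adjacent to neither: r ∑ t² ≥ (∑ t)², multiplied by r.
      -- This is the Krein inequality.
      krein : let r = N - + 2 * K + C - + 2
                  τ = C * (K - + 2) in
        + 0 ≤ r * (r * (C * (K - + 3 * C + C * C)) - τ * τ)
      krein = subst (+ 0 ≤_) y∙y (sum-of-squares y)
        where
        open ≡-Reasoning
        r = N - + 2 * K + C - + 2
        τ = C * (K - + 2)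
        parts : Fin 4 → Vector ℤ n
        parts zero                   = t
        parts (suc zero)             = far
        parts (suc (suc zero))       = unit u
        parts (suc (suc (suc zero))) = unit w
        α : Vector ℤ 4
        -- As `t` equals `C` at `u` and `w`, the last two coefficients make `y` vanish there: `y` is
        -- r t - τ on the r vertices in question and 0 elsewhere. The sum of `t` over these vertices
        -- is τ, namely KC minus C for each of `u` and `w`.
        α zero                   = r
        α (suc zero)             = - τ
        α (suc (suc zero))       = τ - r * C
        α (suc (suc (suc zero))) = τ - r * C
        y = combination α parts
        products : Fin 4 → Fin 4 → ℤ
        products zero zero = (K - C) * C + C * (C * C)
        products zero (suc zero) = K * C
        products (suc zero) zero = K * C
        products zero (suc (suc _)) = C
        products (suc (suc _)) zero = C
        products (suc zero) (suc zero) = N - + 2 * K + C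
        products (suc zero) (suc (suc _)) = + 1
        products (suc (suc _)) (suc zero) = + 1
        products (suc (suc zero)) (suc (suc zero)) = + 1
        products (suc (suc zero)) (suc (suc (suc zero))) = + 0
        products (suc (suc (suc zero))) (suc (suc zero)) = + 0
        products (suc (suc (suc zero))) (suc (suc (suc zero))) = + 1
        parts∙parts : ∀ i j → parts i ∙ parts j ≡ products i j
        parts∙parts zero zero = t∙t
        parts∙parts zero (suc zero) = t∙far
        parts∙parts (suc zero) zero = trans (∙-comm far t) t∙far
        parts∙parts zero (suc (suc zero)) = trans (∙-comm t (unit u)) (trans (∑-unit u t) t-u)
        parts∙parts zero (suc (suc (suc zero))) = trans (∙-comm t (unit w)) (trans (∑-unit w t) t-w)
        parts∙parts (suc (suc zero)) zero = trans (∑-unit u t) t-u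
        parts∙parts (suc (suc (suc zero))) zero = trans (∑-unit w t) t-w
        parts∙parts (suc zero) (suc zero) = far∙far
        parts∙parts (suc zero) (suc (suc zero)) = trans (∙-comm far (unit u)) (trans (∑-unit u far) far-u)
        parts∙parts (suc zero) (suc (suc (suc zero))) = trans (∙-comm far (unit w)) (trans (∑-unit w far) far-w)
        parts∙parts (suc (suc zero)) (suc zero) = trans (∑-unit u far) far-u
        parts∙parts (suc (suc (suc zero))) (suc zero) = trans (∑-unit w far) far-w
        parts∙parts (suc (suc zero)) (suc (suc zero)) = trans (∑-unit u (unit u)) (unit-same u)
        parts∙parts (suc (suc zero)) (suc (suc (suc zero))) = trans (∑-unit u (unit w)) (unit-other (u≢w ∘ sym))
        parts∙parts (suc (suc (suc zero))) (suc (suc zero)) = trans (∑-unit w (unit u)) (unit-other u≢w)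
        parts∙parts (suc (suc (suc zero))) (suc (suc (suc zero))) = trans (∑-unit w (unit w)) (unit-same w)
        y∙y : y ∙ y ≡ r * (r * (C * (K - + 3 * C + C * C)) - τ * τ)
        y∙y = begin
          y ∙ y
            ≡⟨ ∙≡form y y ⟩
          form unit y y
            ≡⟨ form-combination unit α parts ⟩
          sum (λ i → α i * sum (λ j → α j * form unit (parts i) (parts j)))
            ≡⟨ (sum-cong-≋ λ i → cong (α i *_) (sum-cong-≋ λ j → cong (α j *_) (trans (sym (∙≡form (parts i) (parts j))) (parts∙parts i j)))) ⟩
          sum (λ i → α i * sum (λ j → α j * products i j))
            ≡⟨ algebra N K C ⟩
          r * (r * (C * (K - + 3 * C + C * C)) - τ * τ) ∎
          where
          algebra : ∀ N K C → let r = N - + 2 * K + C - + 2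
                                  τ = C * (K - + 2)
                                  γ = τ - r * C in
            r * (r * ((K - C) * C + C * (C * C)) + ((- τ) * (K * C) + (γ * C + (γ * C + + 0)))) +
            ((- τ) * (r * (K * C) + ((- τ) * (N - + 2 * K + C) + (γ * + 1 + (γ * + 1 + + 0)))) +
            (γ * (r * C + ((- τ) * + 1 + (γ * + 1 + (γ * + 0 + + 0)))) +
            (γ * (r * C + ((- τ) * + 1 + (γ * + 0 + (γ * + 1 + + 0)))) + + 0))) ≡
            r * (r * (C * (K - + 3 * C + C * C)) - τ * τ)
          algebra = solve-∀

      blocks : Fin 5 → Vector ℤ n
      blocks zero                         = unit u
      blocks (suc zero)                   = unit v
      blocks (suc (suc zero))             = unit w
      blocks (suc (suc (suc zero)))       = U′
      blocks (suc (suc (suc (suc zero)))) = ρ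

      gram : Fin 5 → Fin 5 → ℤ
      gram zero                   (suc zero)             = + 1
      gram zero                   (suc (suc (suc zero))) = K - C
      gram (suc zero)             zero                   = + 1
      gram (suc zero)             (suc (suc zero))       = + 1
      gram (suc (suc zero))       (suc zero)             = + 1
      gram (suc (suc (suc zero))) zero                   = K - C
      gram (suc (suc (suc zero))) (suc (suc (suc (suc zero)))) = (K - + 2 * C) * (K - C)
      gram (suc (suc (suc (suc zero)))) (suc (suc (suc zero))) = (K - + 2 * C) * (K - C)
      gram (suc (suc (suc (suc zero)))) (suc (suc (suc (suc zero)))) = 2e[ρ] N K C
      gram _ _ = + 0

      private
        formA-blocks : ∀ i j → formA (blocks i) (blocks j) ≡ gram i j
        formA-blocks zero zero = trans (form-unit a u u) (loopless u)
        formA-blocks zero (suc zero) = trans (form-unit a u v) (adjacent u~v)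
        formA-blocks zero (suc (suc zero)) = trans (form-unit a u w) (nonadjacent u≁w)
        formA-blocks zero (suc (suc (suc zero))) = trans (formA-unitˡ u U′) U′-of-u
        formA-blocks zero (suc (suc (suc (suc zero)))) = trans (formA-unitˡ u ρ) ρ-avoids-u
        formA-blocks (suc zero) zero = trans (form-unit a v u) (adjacent v~u)
        formA-blocks (suc zero) (suc zero) = trans (form-unit a v v) (loopless v)
        formA-blocks (suc zero) (suc (suc zero)) = trans (form-unit a v w) (adjacent v~w)
        formA-blocks (suc zero) (suc (suc (suc zero))) = trans (formA-unitˡ v U′) U′-avoids-v
        formA-blocks (suc zero) (suc (suc (suc (suc zero)))) = trans (formA-unitˡ v ρ) ρ-avoids-v
        formA-blocks (suc (suc zero)) zero = trans (form-unit a w u) (nonadjacent w≁u)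
        formA-blocks (suc (suc zero)) (suc zero) = trans (form-unit a w v) (adjacent w~v)
        formA-blocks (suc (suc zero)) (suc (suc zero)) = trans (form-unit a w w) (loopless w)
        formA-blocks (suc (suc zero)) (suc (suc (suc zero))) = trans (formA-unitˡ w U′) U′-avoids-w
        formA-blocks (suc (suc zero)) (suc (suc (suc (suc zero)))) = trans (formA-unitˡ w ρ) ρ-avoids-w
        formA-blocks (suc (suc (suc zero))) zero = trans (formA-sym U′ (unit u)) (trans (formA-unitˡ u U′) U′-of-u)
        formA-blocks (suc (suc (suc zero))) (suc zero) = trans (formA-sym U′ (unit v)) (trans (formA-unitˡ v U′) U′-avoids-v)
        formA-blocks (suc (suc (suc zero))) (suc (suc zero)) = trans (formA-sym U′ (unit w)) (trans (formA-unitˡ w U′) U′-avoids-w)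
        formA-blocks (suc (suc (suc zero))) (suc (suc (suc zero))) = formA-U′-U′
        formA-blocks (suc (suc (suc zero))) (suc (suc (suc (suc zero)))) = formA-U′-ρ
        formA-blocks (suc (suc (suc (suc zero)))) zero = trans (formA-sym ρ (unit u)) (trans (formA-unitˡ u ρ) ρ-avoids-u)
        formA-blocks (suc (suc (suc (suc zero)))) (suc zero) = trans (formA-sym ρ (unit v)) (trans (formA-unitˡ v ρ) ρ-avoids-v)
        formA-blocks (suc (suc (suc (suc zero)))) (suc (suc zero)) = trans (formA-sym ρ (unit w)) (trans (formA-unitˡ w ρ) ρ-avoids-w)
        formA-blocks (suc (suc (suc (suc zero)))) (suc (suc (suc zero))) = trans (formA-sym ρ U′) formA-U′-ρ
        formA-blocks (suc (suc (suc (suc zero)))) (suc (suc (suc (suc zero)))) = formA-ρ-ρ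

      coefficients : ℤ → ℤ → ℤ → ℤ → ℤ → Vector ℤ 5
      coefficients xu xv xw xU xρ zero                         = xu
      coefficients xu xv xw xU xρ (suc zero)                   = xv
      coefficients xu xv xw xU xρ (suc (suc zero))             = xw
      coefficients xu xv xw xU xρ (suc (suc (suc zero)))       = xU
      coefficients xu xv xw xU xρ (suc (suc (suc (suc zero)))) = xρ

      sum-blocks : ∀ xu xv xw xU xρ →
        sum (combination (coefficients xu xv xw xU xρ) blocks) ≡ totalWeight N K C xu xv xw xU xρ
      sum-blocks xu xv xw xU xρ = begin
        sum (combination α blocks)             ≡⟨ sum-combination α blocks ⟩
        sum (λ i → α i * sum (blocks i))       ≡⟨ (sum-cong-≋ λ i → cong (α i *_) (sums i)) ⟩
        sum (λ i → α i * size i)               ≡⟨ algebra xu xv xw xU xρ (K - C) (∣ρ∣ N K C) ⟩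
        totalWeight N K C xu xv xw xU xρ       ∎
        where
        open ≡-Reasoning
        α = coefficients xu xv xw xU xρ
        size : Vector ℤ 5
        size = coefficients (+ 1) (+ 1) (+ 1) (K - C) (∣ρ∣ N K C)
        sums : ∀ i → sum (blocks i) ≡ size i
        sums zero                         = sum-unit u
        sums (suc zero)                   = sum-unit v
        sums (suc (suc zero))             = sum-unit w
        sums (suc (suc (suc zero)))       = sum-U′
        sums (suc (suc (suc (suc zero)))) = sum-ρ
        algebra : ∀ xu xv xw xU xρ d r →
          xu * + 1 + (xv * + 1 + (xw * + 1 + (xU * d + (xρ * r + + 0)))) ≡ xu + xv + xw + xU * d + xρ * r
        algebra = solve-∀

      formA-blocks² : ∀ xu xv xw xU xρ → let x = combination (coefficients xu xv xw xU xρ) blocks in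
        formA x x ≡ edgeWeight×2 N K C xu xv xw xU xρ
      formA-blocks² xu xv xw xU xρ = begin
        formA (combination α blocks) (combination α blocks)
          ≡⟨ form-combination a α blocks ⟩
        sum (λ i → α i * sum (λ j → α j * formA (blocks i) (blocks j)))
          ≡⟨ (sum-cong-≋ λ i → cong (α i *_) (sum-cong-≋ λ j → cong (α j *_) (formA-blocks i j))) ⟩
        sum (λ i → α i * sum (λ j → α j * gram i j))
          ≡⟨ algebra xu xv xw xU xρ (K - C) ((K - + 2 * C) * (K - C)) (2e[ρ] N K C) ⟩
        edgeWeight×2 N K C xu xv xw xU xρ ∎
        where
        open ≡-Reasoning
        α = coefficients xu xv xw xU xρ
        algebra : ∀ xu xv xw xU xρ d f e →
          xu * (xu * + 0 + (xv * + 1 + (xw * + 0 + (xU * d + (xρ * + 0 + + 0))))) +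
          (xv * (xu * + 1 + (xv * + 0 + (xw * + 1 + (xU * + 0 + (xρ * + 0 + + 0))))) +
          (xw * (xu * + 0 + (xv * + 1 + (xw * + 0 + (xU * + 0 + (xρ * + 0 + + 0))))) +
          (xU * (xu * d + (xv * + 0 + (xw * + 0 + (xU * + 0 + (xρ * f + + 0))))) +
          (xρ * (xu * + 0 + (xv * + 0 + (xw * + 0 + (xU * f + (xρ * e + + 0))))) + + 0)))) ≡
          + 2 * xv * (xu + xw) + + 2 * xu * xU * d + + 2 * xU * xρ * f + xρ * xρ * e
        algebra = solve-∀

      -- The blocks are indicators of disjoint sets. Hence a combination of them takes no values
      -- besides 0 and its coefficients, and the bounds on the weights carry over.
      block-at : ∀ x → (∀ j → blocks j x ≡ + 0) ⊎ ∃[ i ] (∀ j → blocks j x ≡ unit i j)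
      block-at x with x Fin.≟ u | x Fin.≟ v | x Fin.≟ w
      ... | yes refl | _ | _ = inj₂ (zero , λ
        { zero                         → unit-same u
        ; (suc zero)                   → unit-other (u≢v ∘ sym)
        ; (suc (suc zero))             → unit-other (u≢w ∘ sym)
        ; (suc (suc (suc zero)))       → cong (_* (+ 1 - a w u)) (loopless u)
        ; (suc (suc (suc (suc zero)))) → ρ-u })
      ... | no _ | yes refl | _ = inj₂ (suc zero , λ
        { zero                         → unit-other u≢v
        ; (suc zero)                   → unit-same v
        ; (suc (suc zero))             → unit-other w≢v
        ; (suc (suc (suc zero)))       → U′-v
        ; (suc (suc (suc (suc zero)))) → ρ-v })
      ... | no _ | no _ | yes refl = inj₂ (suc (suc zero) , λ
        { zero                         → unit-other u≢w
        ; (suc zero)                   → unit-other (w≢v ∘ sym)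
        ; (suc (suc zero))             → unit-same w
        ; (suc (suc (suc zero)))       → U′-w
        ; (suc (suc (suc (suc zero)))) → ρ-w })
      ... | no x≢u | no x≢v | no x≢w = generic (adj G u x) (adj G v x) (adj G w x) refl refl refl
        where
        values : ∀ p q r → Vector ℤ 5
        values p q r = coefficients (+ 0) (+ 0) (+ 0) (⟦ p ⟧ * (+ 1 - ⟦ r ⟧)) ((+ 1 - ⟦ p ⟧) * ((+ 1 - ⟦ q ⟧) * (+ 1 - ⟦ r ⟧)))
        generic : ∀ p q r → adj G u x ≡ p → adj G v x ≡ q → adj G w x ≡ r →
          (∀ j → blocks j x ≡ + 0) ⊎ ∃[ i ] (∀ j → blocks j x ≡ unit i j)
        generic p q r refl refl refl = split p q r (λ
          { zero                         → unit-other (x≢u ∘ sym)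
          ; (suc zero)                   → unit-other (x≢v ∘ sym)
          ; (suc (suc zero))             → unit-other (x≢w ∘ sym)
          ; (suc (suc (suc zero)))       → refl
          ; (suc (suc (suc (suc zero)))) → refl })
          where
          split : ∀ p q r → (∀ j → blocks j x ≡ values p q r j) →
            (∀ j → blocks j x ≡ + 0) ⊎ ∃[ i ] (∀ j → blocks j x ≡ unit i j)
          -- The five indices are spelled out so that `values` and `unit` compute.
          split true  q true h = inj₁ λ
            { zero → h zero ; (suc zero) → h (suc zero) ; (suc (suc zero)) → h (suc (suc zero))
            ; j@(suc (suc (suc zero))) → h j ; j@(suc (suc (suc (suc zero)))) → h j }
          split true  q false h = inj₂ (suc (suc (suc zero)) , λ
            { zero → h zero ; (suc zero) → h (suc zero) ; (suc (suc zero)) → h (suc (suc zero))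
            ; j@(suc (suc (suc zero))) → h j ; j@(suc (suc (suc (suc zero)))) → h j })
          split false true r h = inj₁ λ
            { zero → h zero ; (suc zero) → h (suc zero) ; (suc (suc zero)) → h (suc (suc zero))
            ; j@(suc (suc (suc zero))) → h j ; j@(suc (suc (suc (suc zero)))) → h j }
          split false false true h = inj₁ λ
            { zero → h zero ; (suc zero) → h (suc zero) ; (suc (suc zero)) → h (suc (suc zero))
            ; j@(suc (suc (suc zero))) → h j ; j@(suc (suc (suc (suc zero)))) → h j }
          split false false false h = inj₂ (suc (suc (suc (suc zero))) , λ
            { zero → h zero ; (suc zero) → h (suc zero) ; (suc (suc zero)) → h (suc (suc zero))
            ; j@(suc (suc (suc zero))) → h j ; j@(suc (suc (suc (suc zero)))) → h j })

      combination-value : ∀ α x → combination α blocks x ≡ + 0 ⊎ ∃[ i ] (combination α blocks x ≡ α i)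
      combination-value α x with block-at x
      ... | inj₁ none = inj₁ (trans (sum-cong-≋ λ j → trans (cong (α j *_) (none j)) (ℤ.*-zeroʳ (α j))) (sum-replicate-zero 5))
      ... | inj₂ (i , at-i) = inj₂ (i , trans
        (sum-cong-≋ λ j → trans (cong (α j *_) (at-i j)) (ℤ.*-comm (α j) (unit i j))) (∑-unit i α))

      admissible⇒integralHalf : ∀ W → Admissible n k c W → IntegralHalf G
      admissible⇒integralHalf (weights d@(ℕ.suc _) xu xv xw xU xρ) (_ , (u≤ , v≤ , w≤ , U≤ , ρ≤) , total , sparse) = record
        { denominator = d
        ; weight      = combination α blocks
        ; nonneg      = λ x → within x (λ i → 0ℤ ≤ i) ℤ.≤-refl 0≤α
        ; bounded     = λ x → within x (λ i → i ≤ + d) (+≤+ ℕ.z≤n) α≤d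
        ; total       = trans (cong (+ 2 *_) (sum-blocks (+ xu) (+ xv) (+ xw) (+ xU) (+ xρ))) total
        ; sparse      = subst (λ e → + 25 * e ≤ _) (sym (formA-blocks² (+ xu) (+ xv) (+ xw) (+ xU) (+ xρ))) sparse
        }
        where
        α = coefficients (+ xu) (+ xv) (+ xw) (+ xU) (+ xρ)
        within : ∀ x (P : ℤ → Set) → P 0ℤ → (∀ i → P (α i)) → P (combination α blocks x)
        within x P P0 Pα with combination-value α x
        ... | inj₁ is-0       = subst P (sym is-0) P0
        ... | inj₂ (i , is-i) = subst P (sym is-i) (Pα i)
        0≤α : ∀ i → 0ℤ ≤ α i
        0≤α zero                         = +≤+ ℕ.z≤n
        0≤α (suc zero)                   = +≤+ ℕ.z≤n
        0≤α (suc (suc zero))             = +≤+ ℕ.z≤n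
        0≤α (suc (suc (suc zero)))       = +≤+ ℕ.z≤n
        0≤α (suc (suc (suc (suc zero)))) = +≤+ ℕ.z≤n
        α≤d : ∀ i → α i ≤ + d
        α≤d zero                         = +≤+ u≤
        α≤d (suc zero)                   = +≤+ v≤
        α≤d (suc (suc zero))             = +≤+ w≤
        α≤d (suc (suc (suc zero)))       = +≤+ U≤
        α≤d (suc (suc (suc (suc zero)))) = +≤+ ρ≤

-- Verification of the remaining parameters by computation.

module FiniteCheck where

  open TwoPaths using (Weights; weights; Admissible; totalWeight; edgeWeight×2)
  open import Data.Fin as Fin using (Fin; toℕ)
  import Data.Fin.Properties as Fin
  open import Data.Integer as ℤ using (ℤ; +_)
  import Data.Integer.Properties as ℤ
  open import Data.List using (List; []; _∷_)
  open import Data.List.Relation.Unary.Any as Any using (Any)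
  open import Data.Nat hiding (_/_)
  open import Data.Nat.DivMod using (_/_; m*n/n≡m)
  open import Data.Nat.Properties
  open import Data.Product using (_×_; proj₁)
  open import Relation.Binary.PropositionalEquality
  open import Relation.Nullary using (Dec; _×-dec_; _→-dec_)
  open import Relation.Nullary.Decidable using (toWitness)

  admissible? : ∀ n k c W → Dec (Admissible n k c W)
  admissible? n k c (weights d xu xv xw xU xρ) =
    0 <? d ×-dec (xu ≤? d ×-dec xv ≤? d ×-dec xw ≤? d ×-dec xU ≤? d ×-dec xρ ≤? d) ×-dec
    (_ ℤ.≟ _) ×-dec (_ ℤ.≤? _)

  -- Each choice fixes all weights but one, which is then forced by the total.
  choices : ℕ → ℕ → ℕ → List Weights
  choices n k c =
    weights d₁ d₁ d₁ d₁ 0 (n ∸ 6) ∷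
    weights d₂ d₂ d₂ d₂ (n ∸ (6 + d₁)) d₂ ∷
    weights d₂ 0 d₂ d₂ (n ∸ (4 + d₁)) d₂ ∷
    weights d₂ d₂ 0 d₂ (n ∸ 4) 0 ∷ []
    where
    -- Twice the sizes of R and of U′: what is missing from n/2, spread evenly over the respective
    -- set, is then integral over the denominator. Truncated subtraction is harmless, since
    -- `Admissible` checks the total in ℤ.
    d₁ = 2 * (n + c ∸ 3 * k)
    d₂ = 2 * (k ∸ c)

  -- The first condition is `order-equation` rearranged so that no subtraction occurs; the last is
  -- `krein`.
  Feasible : ℕ → ℕ → ℕ → Set
  Feasible n k c =
    c * n + k ≡ k * k + c + c * k × 4 * n < 25 * k × 2 * k < n ×
    (let r = N ℤ.- + 2 ℤ.* K ℤ.+ C ℤ.- + 2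
         τ = C ℤ.* (K ℤ.- + 2) in
     + 0 ℤ.≤ r ℤ.* (r ℤ.* (C ℤ.* (K ℤ.- + 3 ℤ.* C ℤ.+ C ℤ.* C)) ℤ.- τ ℤ.* τ))
    where
    N = + n
    K = + k
    C = + c

  feasible? : ∀ n k c → Dec (Feasible n k c)
  feasible? n k c = (_ ≟ _) ×-dec (_ <? _) ×-dec (_ <? _) ×-dec (_ ℤ.≤? _)

  -- The first condition of `Feasible` solved for n. If the division is not exact, the rounded
  -- quotient violates that condition, so `Feasible` fails.
  order : ℕ → (c : ℕ) .{{_ : NonZero c}} → ℕ
  order k c = (k * k + c + c * k ∸ k) / c

  -- Computing n from k and c leaves 15 · 80 cases, which are settled by evaluating the decision
  -- procedures. The shift by `suc` starts c at 1.
  finite-check : ∀ (c : Fin 15) (k : Fin 80) →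
    let c′ = suc (toℕ c) ; k′ = toℕ k ; n′ = order k′ c′ in
    Feasible n′ k′ c′ → Any (Admissible n′ k′ c′) (choices n′ k′ c′)
  finite-check = toWitness {a? = Fin.all? {n = 15} λ c → Fin.all? {n = 80} λ k →
    let c′ = suc (toℕ c) ; k′ = toℕ k ; n′ = order k′ c′ in
    feasible? n′ k′ c′ →-dec Any.any? (admissible? n′ k′ c′) (choices n′ k′ c′)} _

  feasible⇒admissible : ∀ {n k c} → 0 < c → c ≤ 15 → k < 80 → Feasible n k c →
    Any (Admissible n k c) (choices n k c)
  feasible⇒admissible {n} {k} {c@(suc c-1)} 0<c c≤15 k<80 feasible =
    subst (λ m → Any (Admissible m k c) (choices m k c)) (sym n≡)
      (lemma (subst (λ m → Feasible m k c) n≡ feasible))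
    where
    n≡ : n ≡ order k c
    n≡ = begin
      n                               ≡⟨ m*n/n≡m n c ⟨
      (n * c) / c                     ≡⟨ cong (_/ c) (*-comm n c) ⟩
      (c * n) / c                     ≡⟨ cong (_/ c) (m+n∸n≡m (c * n) k) ⟨
      (c * n + k ∸ k) / c             ≡⟨ cong (λ m → (m ∸ k) / c) (proj₁ feasible) ⟩
      order k c                       ∎
      where open ≡-Reasoning
    lemma : Feasible (order k c) k c → Any (Admissible (order k c) k c) (choices (order k c) k c)
    lemma = subst₂ (λ c-1 k → let c = suc c-1 in
        Feasible (order k c) k c → Any (Admissible (order k c) k c) (choices (order k c) k c))
      (Fin.toℕ-fromℕ< c≤15) (Fin.toℕ-fromℕ< k<80)
      (finite-check (Fin.fromℕ< c≤15) (Fin.fromℕ< k<80))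

-- Bounds on degree and common-neighbour number.

module ParameterBounds where

  open FiniteCheck using (Feasible)
  open import Data.Integer hiding (suc)
  import Data.Integer.Properties as ℤ
  open import Data.Integer.Tactic.RingSolver using (solve-∀)
  open import Data.Nat as ℕ using (ℕ; suc; s≤s; z≤n)
  import Data.Nat.Properties as ℕ
  import Data.Nat.Tactic.RingSolver as ℕ-Solver
  open import Data.Product using (_×_; _,_)
  open import Relation.Binary.PropositionalEquality
  open import Relation.Nullary using (¬_; yes; no; contradiction)

  0≤ : ∀ n → 0ℤ ≤ + n
  0≤ n = +≤+ z≤n

  0≤+ : ∀ {i j} → 0ℤ ≤ i → 0ℤ ≤ j → 0ℤ ≤ i + j
  0≤+ = ℤ.+-mono-≤

  0≤* : ∀ {i j} → 0ℤ ≤ i → 0ℤ ≤ j → 0ℤ ≤ i * j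
  0≤* {+ m} {+ n} _ _ = subst (0ℤ ≤_) (ℤ.pos-* m n) (0≤ (m ℕ.* n))

  -- With C = 16 + J and K = 1 + C + M, the lower bounds on C and K turn into nonnegativity of J and
  -- M. The claim then reduces to polynomials in J, M and the slack 21C + 3 - 4K with nonnegative
  -- coefficients only.
  large-c-impossible : ∀ N K C J M → C ≡ + 16 + J → K ≡ + 1 + C + M →
    0ℤ ≤ J → 0ℤ ≤ M → 0ℤ ≤ + 21 * C + + 3 - + 4 * K →
    let r = N - + 2 * K + C - + 2
        τ = C * (K - + 2) in
    C * N + K ≡ K * K + C + C * K →
    ¬ (0ℤ ≤ r * (r * (C * (K - + 3 * C + C * C)) - τ * τ))
  large-c-impossible N K C J@(+ j) M@(+ m) refl refl 0≤J 0≤M 0≤l order krein =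
    ℤ.<⇒≱ I<0 0≤I
    where
    r = N - + 2 * K + C - + 2
    τ = C * (K - + 2)
    I = r * (C * (K - + 3 * C + C * C)) - τ * τ
    l = + 21 * C + + 3 - + 4 * K

    -- The order equation determines C N, hence C r but not r, as a polynomial in C and K. The value
    -- is positive, so r > 0 and the outer factor r of the Krein inequality can be cancelled.
    C*r : C * r ≡ + 1 + (+ 239 + + 31 * J + J * J + (+ 17 + J + M) * M)
    C*r = trans (regroup C N K) (trans (cong (_+ (- K - + 2 * C * K + C * C - + 2 * C)) order) (collect J M))
      where
      regroup : ∀ C N K → C * (N - + 2 * K + C - + 2) ≡ (C * N + K) + (- K - + 2 * C * K + C * C - + 2 * C)
      regroup = solve-∀
      collect : ∀ J M → let C = + 16 + J ; K = + 1 + C + M in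
        (K * K + C + C * K) + (- K - + 2 * C * K + C * C - + 2 * C) ≡
        + 1 + (+ 239 + + 31 * J + J * J + (+ 17 + J + M) * M)
      collect = solve-∀

    0<r : 0ℤ < r
    0<r = ℤ.*-cancelˡ-<-nonNeg C (subst₂ _<_ (sym (ℤ.*-zeroʳ C)) (sym C*r)
      (ℤ.<-≤-trans (+<+ (s≤s z≤n)) (ℤ.+-monoʳ-≤ (+ 1)
        (0≤+ (0≤+ (0≤+ (0≤ 239) (0≤* (0≤ 31) 0≤J)) (0≤* 0≤J 0≤J))
             (0≤* (0≤+ (0≤+ (0≤ 17) 0≤J) 0≤M) 0≤M)))))

    0≤I : 0ℤ ≤ I
    0≤I = ℤ.*-cancelˡ-≤-pos 0ℤ I r {{positive 0<r}} (subst (_≤ r * I) (sym (ℤ.*-zeroʳ r)) krein)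

    -- A certificate of negativity: -16 I - 1 written with nonnegative coefficients in J, M and the
    -- slack `l`. The factor 16 clears the denominators caused by 4K in `l`.
    gap : ℤ
    gap = + 4 * (+ 1 + M) * (+ 1 + M) * l + (+ 207 + + 13 * J) * (+ 1 + M) * l
        + (+ 16 * J * J * J + + 515 * J * J + + 4170 * J) * (+ 1 + M) + (+ 418 + + 419 * M)

    16I : + 16 * I ≡ - (+ 1 + gap)
    16I = trans (regroup C r K) (trans (cong (λ s → + 16 * (s * (K - + 3 * C + C * C) - τ * τ)) C*r) (collect J M))
      where
      regroup : ∀ C r K → let τ = C * (K - + 2) in
        + 16 * (r * (C * (K - + 3 * C + C * C)) - τ * τ) ≡ + 16 * ((C * r) * (K - + 3 * C + C * C) - τ * τ)
      regroup = solve-∀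
      collect : ∀ J M → let C = + 16 + J ; K = + 1 + C + M ; τ = C * (K - + 2) ; l = + 21 * C + + 3 - + 4 * K in
        + 16 * ((+ 1 + (+ 239 + + 31 * J + J * J + (+ 17 + J + M) * M)) * (K - + 3 * C + C * C) - τ * τ) ≡
        - (+ 1 + (+ 4 * (+ 1 + M) * (+ 1 + M) * l + (+ 207 + + 13 * J) * (+ 1 + M) * l
        + (+ 16 * J * J * J + + 515 * J * J + + 4170 * J) * (+ 1 + M) + (+ 418 + + 419 * M)))
      collect = solve-∀

    0≤gap : 0ℤ ≤ gap
    0≤gap =
      0≤+ (0≤+ (0≤+ (0≤* (0≤* (0≤* (0≤ 4) 0≤1+M) 0≤1+M) 0≤l) (0≤* (0≤* (0≤+ (0≤ 207) (0≤* (0≤ 13) 0≤J)) 0≤1+M) 0≤l))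
        (0≤* (0≤+ (0≤+ (0≤* (0≤* (0≤* (0≤ 16) 0≤J) 0≤J) 0≤J) (0≤* (0≤* (0≤ 515) 0≤J) 0≤J)) (0≤* (0≤ 4170) 0≤J)) 0≤1+M))
        (0≤+ (0≤ 418) (0≤* (0≤ 419) 0≤M))
      where
      0≤1+M : 0ℤ ≤ + 1 + M
      0≤1+M = 0≤+ (0≤ 1) 0≤M

    I<0 : I < 0ℤ
    I<0 = ℤ.*-cancelˡ-<-nonNeg (+ 16) (subst (_< + 16 * 0ℤ) (sym 16I)
      (ℤ.neg-mono-< {0ℤ} (ℤ.<-≤-trans (+<+ (s≤s z≤n)) (ℤ.+-monoʳ-≤ (+ 1) 0≤gap))))

  module _ {n k c : ℕ} (1<k : 1 ℕ.< k) (0<c : 0 ℕ.< c) where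

    -- Multiplying 4n + 1 ≤ 25k by c and inserting the order equation gives 4k² + 5c ≤ k(21c + 4).
    -- If 4k ≥ 21c + 4, this leaves 5c ≤ 0.
    4k≤21c+3 : c ℕ.* n ℕ.+ k ≡ k ℕ.* k ℕ.+ c ℕ.+ c ℕ.* k → 4 ℕ.* n ℕ.< 25 ℕ.* k →
      4 ℕ.* k ℕ.≤ 21 ℕ.* c ℕ.+ 3
    4k≤21c+3 order 4n<25k with 4 ℕ.* k ℕ.≤? 21 ℕ.* c ℕ.+ 3
    ... | yes p = p
    ... | no ¬p = contradiction (ℕ.+-cancelʳ-≤ (25 ℕ.* (c ℕ.* k) ℕ.+ 4 ℕ.* k) (5 ℕ.* c) 0 (begin
      5 ℕ.* c ℕ.+ (25 ℕ.* (c ℕ.* k) ℕ.+ 4 ℕ.* k)                      ≡⟨ e₁ c k ⟩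
      k ℕ.* suc (21 ℕ.* c ℕ.+ 3) ℕ.+ (5 ℕ.* c ℕ.+ 4 ℕ.* (c ℕ.* k))    ≤⟨ ℕ.+-monoˡ-≤ _ (ℕ.*-monoʳ-≤ k (ℕ.≰⇒> ¬p)) ⟩
      k ℕ.* (4 ℕ.* k) ℕ.+ (5 ℕ.* c ℕ.+ 4 ℕ.* (c ℕ.* k))               ≡⟨ e₂ c k ⟩
      4 ℕ.* (k ℕ.* k ℕ.+ c ℕ.+ c ℕ.* k) ℕ.+ c                         ≡⟨ cong (λ a → 4 ℕ.* a ℕ.+ c) order ⟨
      4 ℕ.* (c ℕ.* n ℕ.+ k) ℕ.+ c                                     ≡⟨ e₃ c n k ⟩
      c ℕ.* suc (4 ℕ.* n) ℕ.+ 4 ℕ.* k                                 ≤⟨ ℕ.+-monoˡ-≤ _ (ℕ.*-monoʳ-≤ c 4n<25k) ⟩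
      c ℕ.* (25 ℕ.* k) ℕ.+ 4 ℕ.* k                                    ≡⟨ e₄ c k ⟩
      25 ℕ.* (c ℕ.* k) ℕ.+ 4 ℕ.* k                                    ∎))
      (ℕ.<⇒≱ (ℕ.≤-trans 0<c (ℕ.m≤m+n c _)))
      where
      open ℕ.≤-Reasoning
      e₁ : ∀ c k → 5 ℕ.* c ℕ.+ (25 ℕ.* (c ℕ.* k) ℕ.+ 4 ℕ.* k) ≡ k ℕ.* suc (21 ℕ.* c ℕ.+ 3) ℕ.+ (5 ℕ.* c ℕ.+ 4 ℕ.* (c ℕ.* k))
      e₁ = ℕ-Solver.solve-∀
      e₂ : ∀ c k → k ℕ.* (4 ℕ.* k) ℕ.+ (5 ℕ.* c ℕ.+ 4 ℕ.* (c ℕ.* k)) ≡ 4 ℕ.* (k ℕ.* k ℕ.+ c ℕ.+ c ℕ.* k) ℕ.+ c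
      e₂ = ℕ-Solver.solve-∀
      e₃ : ∀ c n k → 4 ℕ.* (c ℕ.* n ℕ.+ k) ℕ.+ c ≡ c ℕ.* suc (4 ℕ.* n) ℕ.+ 4 ℕ.* k
      e₃ = ℕ-Solver.solve-∀
      e₄ : ∀ c k → c ℕ.* (25 ℕ.* k) ℕ.+ 4 ℕ.* k ≡ 25 ℕ.* (c ℕ.* k) ℕ.+ 4 ℕ.* k
      e₄ = ℕ-Solver.solve-∀

    -- If k ≤ c, the order equation gives cn ≤ 2ck + c - k < c(2k + 1), against 2k + 1 ≤ n.
    c<k : c ℕ.* n ℕ.+ k ≡ k ℕ.* k ℕ.+ c ℕ.+ c ℕ.* k → 2 ℕ.* k ℕ.< n → c ℕ.< k
    c<k order 2k<n with c ℕ.<? k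
    ... | yes p = p
    ... | no ¬p = contradiction (ℕ.+-cancelʳ-≤ (2 ℕ.* (c ℕ.* k) ℕ.+ c) k 0 (begin
      k ℕ.+ (2 ℕ.* (c ℕ.* k) ℕ.+ c)       ≡⟨ e₁ c k ⟩
      c ℕ.* suc (2 ℕ.* k) ℕ.+ k           ≤⟨ ℕ.+-monoˡ-≤ k (ℕ.*-monoʳ-≤ c 2k<n) ⟩
      c ℕ.* n ℕ.+ k                       ≡⟨ order ⟩
      k ℕ.* k ℕ.+ c ℕ.+ c ℕ.* k           ≤⟨ ℕ.+-monoˡ-≤ (c ℕ.* k) (ℕ.+-monoˡ-≤ c (ℕ.*-monoˡ-≤ k (ℕ.≮⇒≥ ¬p))) ⟩
      c ℕ.* k ℕ.+ c ℕ.+ c ℕ.* k           ≡⟨ e₂ c k ⟩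
      2 ℕ.* (c ℕ.* k) ℕ.+ c               ∎))
      (ℕ.<⇒≱ (ℕ.<-trans (s≤s z≤n) 1<k))
      where
      open ℕ.≤-Reasoning
      e₁ : ∀ c k → k ℕ.+ (2 ℕ.* (c ℕ.* k) ℕ.+ c) ≡ c ℕ.* suc (2 ℕ.* k) ℕ.+ k
      e₁ = ℕ-Solver.solve-∀
      e₂ : ∀ c k → c ℕ.* k ℕ.+ c ℕ.+ c ℕ.* k ≡ 2 ℕ.* (c ℕ.* k) ℕ.+ c
      e₂ = ℕ-Solver.solve-∀

    feasible-bounds : Feasible n k c → c ℕ.≤ 15 × k ℕ.< 80
    feasible-bounds (order , 4n<25k , 2k<n , krein) = c≤15 , k<80
      where
      4k≤ = 4k≤21c+3 order 4n<25k

      c≤15 : c ℕ.≤ 15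
      c≤15 with c ℕ.≤? 15
      ... | yes p = p
      ... | no ¬p = contradiction krein (impossible (ℕ.≰⇒> ¬p) (c<k order 2k<n) order 4k≤)
        where
        impossible : 16 ℕ.≤ c → c ℕ.< k → c ℕ.* n ℕ.+ k ≡ k ℕ.* k ℕ.+ c ℕ.+ c ℕ.* k → 4 ℕ.* k ℕ.≤ 21 ℕ.* c ℕ.+ 3 → _
        impossible 16≤c c<k order 4k≤ =
          let j , 16+j≡c = ℕ.m≤n⇒∃[o]m+o≡n 16≤c
              m , 1+c+m≡k = ℕ.m≤n⇒∃[o]m+o≡n c<k
          in large-c-impossible (+ n) K C (+ j) (+ m) (cong +_ (sym 16+j≡c)) (cong +_ (sym 1+c+m≡k))
               (0≤ j) (0≤ m) 0≤l order-ℤ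
          where
          C = + c
          K = + k
          order-ℤ : C * + n + K ≡ K * K + C + C * K
          order-ℤ = begin
            C * + n + K                                  ≡⟨ cong (_+ K) (ℤ.pos-* c n) ⟨
            + (c ℕ.* n ℕ.+ k)                            ≡⟨ cong +_ order ⟩
            + (k ℕ.* k ℕ.+ c ℕ.+ c ℕ.* k)                ≡⟨ cong₂ (λ s t → s + C + t) (ℤ.pos-* k k) (ℤ.pos-* c k) ⟩
            K * K + C + C * K                            ∎
            where open ≡-Reasoning
          0≤l : 0ℤ ≤ + 21 * C + + 3 - + 4 * K
          0≤l = subst (0ℤ ≤_) (cong₂ (λ s t → s + + 3 - t) (ℤ.pos-* 21 c) (ℤ.pos-* 4 k))
            (ℤ.i≤j⇒0≤j-i (+≤+ 4k≤))

      -- 4k ≤ 21 · 15 + 3 = 318 < 320.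
      k<80 : k ℕ.< 80
      k<80 = ℕ.*-cancelˡ-< 4 k 80 (s≤s (ℕ.≤-trans 4k≤
        (ℕ.≤-trans (ℕ.+-monoˡ-≤ 3 (ℕ.*-monoʳ-≤ 21 c≤15)) (ℕ.m≤m+n 318 1))))

-- A sparse half for every triangle-free strongly regular graph.

module SparseHalves where

  open IntegralHalves using (module ∑ℤ; IntegralHalf)
  open TwoPaths
  open FiniteCheck
  open ParameterBounds
  open import Defs using (Graph; adj; neighbours; TriangleFree)
  open import Data.Bool using (Bool; true; false)
  open import Data.Fin as Fin using (Fin; zero; suc)
  import Data.Fin.Properties as Fin
  open import Data.Fin.Subset using (∣_∣; _∩_)
  open import Data.Integer hiding (suc; ∣_∣; NonZero)
  import Data.Integer.Properties as ℤ
  open import Data.Integer.Tactic.RingSolver using (solve-∀)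
  import Data.List.Relation.Unary.Any as Any
  open import Data.Nat as ℕ using (ℕ; NonZero; s≤s; z≤n)
  import Data.Nat.Properties as ℕ
  open import Data.Product using (_×_; _,_; ∃-syntax; proj₁; proj₂)
  open import Data.Vec using (tabulate)
  open import Data.Vec.Functional using (Vector)
  open import Function using (_∘_)
  open import Relation.Binary.PropositionalEquality
  open import Relation.Nullary using (yes; no; contradiction)
  open import Relation.Nullary.Decidable using (toWitness)
  open ∑ℤ

  member : ∀ {n} (f : Fin n → Bool) → 1 ℕ.≤ ∣ tabulate f ∣ → ∃[ i ] f i ≡ true
  member {ℕ.suc n} f 1≤ with f zero in f0
  ... | true  = zero , f0
  ... | false = let i , fi = member (f ∘ suc) 1≤ in suc i , fi

  two-members : ∀ {n} (f : Fin n → Bool) → 2 ℕ.≤ ∣ tabulate f ∣ →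
    ∃[ i ] ∃[ j ] (i ≢ j × f i ≡ true × f j ≡ true)
  two-members {ℕ.suc n} f 2≤ with f zero in f0
  ... | true  = let j , fj = member (f ∘ suc) (ℕ.≤-pred 2≤) in zero , suc j , (λ ()) , f0 , fj
  ... | false = let i , j , i≢j , fi , fj = two-members (f ∘ suc) 2≤
                in suc i , suc j , i≢j ∘ Fin.suc-injective , fi , fj

  module _ {n : ℕ} (G : Graph n) (triangleFree : TriangleFree G)
    (k : ℕ) (regular : ∀ v → ∣ neighbours G v ∣ ≡ k)
    (c : ℕ) (common : ∀ v w → v ≢ w → adj G v w ≡ false →
      ∣ neighbours G v ∩ neighbours G w ∣ ≡ c) where

    open StronglyRegular G triangleFree k regular c common

    -- There are kn/2 edges, each of weight 1/4, so the density is k/(8n).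
    uniformHalf : 25 ℕ.* k ℕ.≤ 4 ℕ.* n → IntegralHalf G
    uniformHalf 25k≤4n = record
      { denominator = 2
      ; weight      = one
      ; nonneg      = λ _ → +≤+ z≤n
      ; bounded     = λ _ → +≤+ (s≤s z≤n)
      ; total       = trans (cong (+ 2 *_) sum-one) (ℤ.*-comm (+ 2) N)
      ; sparse      = begin
          + 25 * formA one one      ≡⟨ cong (+ 25 *_) (trans (formA-oneʳ one) (cong (K *_) sum-one)) ⟩
          + 25 * (K * N)            ≡⟨ ℤ.*-assoc (+ 25) K N ⟨
          + 25 * K * N              ≤⟨ ℤ.*-monoʳ-≤-nonNeg N (subst₂ _≤_ (ℤ.pos-* 25 k) (ℤ.pos-* 4 n) (+≤+ 25k≤4n)) ⟩
          + 4 * N * N               ≡⟨ algebra N ⟩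
          (N * N) * (+ 2 * + 2)     ∎
      }
      where
      open ℤ.≤-Reasoning
      algebra : ∀ N → + 4 * N * N ≡ (N * N) * (+ 2 * + 2)
      algebra = solve-∀

    -- N(v) is independent, so the density is 0. Having at least n/2 vertices, N(v) can carry the
    -- whole total with weight n/(2k) ≤ 1 on each of them.
    neighbourhoodHalf : .{{NonZero k}} → n ℕ.≤ 2 ℕ.* k → Fin n → IntegralHalf G
    neighbourhoodHalf n≤2k v = record
      { denominator   = 2 ℕ.* k
      ; denominator≢0 = ℕ.m*n≢0 2 k
      ; weight        = λ x → N * a v x
      ; nonneg        = λ x → ⟦⟧-cases (adj G v x) (λ i → 0ℤ ≤ N * i) (subst (0ℤ ≤_) (sym (ℤ.*-identityʳ N)) (0≤ n))
                                (subst (0ℤ ≤_) (sym (ℤ.*-zeroʳ N)) (0≤ 0))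
      ; bounded       = λ x → ⟦⟧-cases (adj G v x) (λ i → N * i ≤ + (2 ℕ.* k)) (subst (_≤ _) (sym (ℤ.*-identityʳ N)) (+≤+ n≤2k))
                                (subst (_≤ _) (sym (ℤ.*-zeroʳ N)) (0≤ _))
      ; total         = begin
          + 2 * sum (λ x → N * a v x)   ≡⟨ cong (+ 2 *_) (trans (∑-*ˡ N (a v)) (cong (N *_) (degree v))) ⟩
          + 2 * (N * K)                 ≡⟨ algebra N K ⟩
          N * (+ 2 * K)                 ≡⟨ cong (N *_) (ℤ.pos-* 2 k) ⟨
          N * + (2 ℕ.* k)               ∎
      ; sparse        = subst (λ e → + 25 * e ≤ _)
          (sym (inside v (λ _ → N) (λ _ → N) (λ x → ℤ.*-comm N (a v x)) (λ x → ℤ.*-comm N (a v x))))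
          (0≤* (0≤* (0≤ n) (0≤ n)) (0≤* (0≤ (2 ℕ.* k)) (0≤ (2 ℕ.* k))))
      }
      where
      open ≡-Reasoning
      ⟦⟧-cases : ∀ b (P : ℤ → Set) → P (+ 1) → P (+ 0) → P ⟦ b ⟧
      ⟦⟧-cases true  P P1 P0 = P1
      ⟦⟧-cases false P P1 P0 = P0
      algebra : ∀ N K → + 2 * (N * K) ≡ N * (+ 2 * K)
      algebra = solve-∀

    module _ (u v : Fin n) (u~v : adj G u v ≡ true) where

      -- If k = 1, then N(u) consists of `v` and N(v) of `u`; over the denominator 2 this is weight
      -- 1 on `v`, 0 on `u` and ½ elsewhere.
      tilted : Vector ℤ n
      tilted x = + 1 + (a u x - a v x)

      private
        parts : Fin 3 → Vector ℤ n
        parts zero             = one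
        parts (suc zero)       = a u
        parts (suc (suc zero)) = a v

        signs : Vector ℤ 3
        signs zero             = + 1
        signs (suc zero)       = + 1
        signs (suc (suc zero)) = - + 1

        tilted≡ : ∀ x → tilted x ≡ combination signs parts x
        tilted≡ x = algebra (a u x) (a v x)
          where
          algebra : ∀ p q → + 1 + (p - q) ≡ + 1 * + 1 + (+ 1 * p + ((- + 1) * q + + 0))
          algebra = solve-∀

        uv : ℤ
        uv = (K - C) * + 1 + C * (K - + 0)

        formA-u-v : formA (a u) (a v) ≡ uv
        formA-u-v = trans (formA-neighboursʳ (a u) v)
          (cong₂ (λ i j → (K - C) * i + C * j) (adjacent u~v)
            (cong₂ _-_ (degree u) (trans (∙-comm (a v) (a u)) (sum-zero (disjoint u~v)))))

        gram-parts : Fin 3 → Fin 3 → ℤ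
        gram-parts zero             zero             = K * N
        gram-parts zero             (suc _)          = K * K
        gram-parts (suc _)          zero             = K * K
        gram-parts (suc zero)       (suc zero)       = + 0
        gram-parts (suc zero)       (suc (suc zero)) = uv
        gram-parts (suc (suc zero)) (suc zero)       = uv
        gram-parts (suc (suc zero)) (suc (suc zero)) = + 0

        formA-one-neighbours : ∀ p → formA (a p) one ≡ K * K
        formA-one-neighbours p = trans (formA-oneʳ (a p)) (cong (K *_) (degree p))

        within-neighbours : ∀ p → formA (a p) (a p) ≡ + 0
        within-neighbours p = inside p one one (λ x → sym (ℤ.*-identityʳ (a p x))) (λ x → sym (ℤ.*-identityʳ (a p x)))

        formA-parts : ∀ i j → formA (parts i) (parts j) ≡ gram-parts i j
        formA-parts zero             zero             = trans (formA-oneʳ one) (cong (K *_) sum-one)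
        formA-parts zero             (suc zero)       = trans (formA-sym one (a u)) (formA-one-neighbours u)
        formA-parts zero             (suc (suc zero)) = trans (formA-sym one (a v)) (formA-one-neighbours v)
        formA-parts (suc zero)       zero             = formA-one-neighbours u
        formA-parts (suc (suc zero)) zero             = formA-one-neighbours v
        formA-parts (suc zero)       (suc zero)       = within-neighbours u
        formA-parts (suc zero)       (suc (suc zero)) = formA-u-v
        formA-parts (suc (suc zero)) (suc zero)       = trans (formA-sym (a v) (a u)) formA-u-v
        formA-parts (suc (suc zero)) (suc (suc zero)) = within-neighbours v

      -- By regularity the terms linear in `a u` and `a v` cancel, and both neighbourhoods are
      -- independent. What remains is the cross term: K + (K - 1)C edges join N(u) and N(v), since
      -- `u` sees all of N(u) and every other vertex of N(v) sees C of it.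
      formA-tilted : formA tilted tilted ≡ K * N - + 2 * (K - C + C * K)
      formA-tilted = begin
        formA tilted tilted
          ≡⟨ form-cong a tilted≡ tilted≡ ⟩
        formA (combination signs parts) (combination signs parts)
          ≡⟨ form-combination a signs parts ⟩
        sum (λ i → signs i * sum (λ j → signs j * formA (parts i) (parts j)))
          ≡⟨ (sum-cong-≋ λ i → cong (signs i *_) (sum-cong-≋ λ j → cong (signs j *_) (formA-parts i j))) ⟩
        sum (λ i → signs i * sum (λ j → signs j * gram-parts i j))
          ≡⟨ algebra N K C ⟩
        K * N - + 2 * (K - C + C * K) ∎
        where
        open ≡-Reasoning
        algebra : ∀ N K C → let m = (K - C) * + 1 + C * (K - + 0) in
          + 1 * (+ 1 * (K * N) + (+ 1 * (K * K) + ((- + 1) * (K * K) + + 0))) +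
          (+ 1 * (+ 1 * (K * K) + (+ 1 * + 0 + ((- + 1) * m + + 0))) +
          ((- + 1) * (+ 1 * (K * K) + (+ 1 * m + ((- + 1) * + 0 + + 0))) + + 0)) ≡
          K * N - + 2 * (K - C + C * K)
        algebra = solve-∀

      sum-tilted : sum tilted ≡ N
      sum-tilted = begin
        sum tilted                                    ≡⟨ sum-cong-≋ tilted≡ ⟩
        sum (combination signs parts)                 ≡⟨ sum-combination signs parts ⟩
        + 1 * sum one + (+ 1 * sum (a u) + ((- + 1) * sum (a v) + + 0))
          ≡⟨ cong₂ (λ s t → + 1 * s + t) sum-one (cong₂ (λ s t → + 1 * s + ((- + 1) * t + + 0)) (degree u) (degree v)) ⟩
        + 1 * N + (+ 1 * K + ((- + 1) * K + + 0))     ≡⟨ algebra N K ⟩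
        N                                             ∎
        where
        open ≡-Reasoning
        algebra : ∀ N K → + 1 * N + (+ 1 * K + ((- + 1) * K + + 0)) ≡ N
        algebra = solve-∀

      matchingHalf : k ≡ 1 → 4 ℕ.* n ℕ.< 25 → IntegralHalf G
      matchingHalf k≡1 4n<25 = record
        { denominator = 2
        ; weight      = tilted
        ; nonneg      = λ x → proj₁ (within (adj G u x) (adj G v x))
        ; bounded     = λ x → proj₂ (within (adj G u x) (adj G v x))
        ; total       = trans (cong (+ 2 *_) sum-tilted) (ℤ.*-comm (+ 2) N)
        ; sparse      = subst (λ e → + 25 * e ≤ (N * N) * (+ 2 * + 2)) (sym formA≡)
            (subst (λ m → + 25 * (+ m - + 2) ≤ (+ m * + m) * (+ 2 * + 2)) (Fin.toℕ-fromℕ< n<7) (small (Fin.fromℕ< n<7)))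
        }
        where
        within : ∀ p q → 0ℤ ≤ + 1 + (⟦ p ⟧ - ⟦ q ⟧) × + 1 + (⟦ p ⟧ - ⟦ q ⟧) ≤ + 2
        within true  true  = +≤+ z≤n , +≤+ (s≤s z≤n)
        within true  false = +≤+ z≤n , +≤+ (s≤s (s≤s z≤n))
        within false true  = +≤+ z≤n , +≤+ z≤n
        within false false = +≤+ z≤n , +≤+ (s≤s z≤n)
        formA≡ : formA tilted tilted ≡ N - + 2
        formA≡ = trans formA-tilted (trans (cong (λ m → + m * N - + 2 * (+ m - C + C * + m)) k≡1) (algebra N C))
          where
          algebra : ∀ N C → + 1 * N - + 2 * (+ 1 - C + C * + 1) ≡ N - + 2
          algebra = solve-∀
        n<7 : n ℕ.< 7
        n<7 = ℕ.*-cancelˡ-< 4 n 7 (ℕ.<-trans 4n<25 (ℕ.m≤m+n 26 2))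
        small : ∀ (i : Fin 7) → let m = + Fin.toℕ i in + 25 * (m - + 2) ≤ (m * m) * (+ 2 * + 2)
        small = toWitness {a? = Fin.all? {n = 7} λ i → _ ℤ.≤? _} _

    order-ℕ : Fin n → c ℕ.* n ℕ.+ k ≡ k ℕ.* k ℕ.+ c ℕ.+ c ℕ.* k
    order-ℕ v = ℤ.+-injective (begin
      + (c ℕ.* n) + K                           ≡⟨ cong (_+ K) (ℤ.pos-* c n) ⟩
      C * N + K                                 ≡⟨ regroup N K C ⟩
      ((K - C) + C * (N - K)) + C + C * K       ≡⟨ cong (λ s → s + C + C * K) (order-equation v) ⟨
      K * K + C + C * K                         ≡⟨ cong₂ (λ s t → s + C + t) (ℤ.pos-* k k) (ℤ.pos-* c k) ⟨
      + (k ℕ.* k) + C + + (c ℕ.* k)             ∎)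
      where
      open ≡-Reasoning
      regroup : ∀ N K C → C * N + K ≡ ((K - C) + C * (N - K)) + C + C * K
      regroup = solve-∀

    twoPathHalf : Fin n → 2 ℕ.≤ k → 4 ℕ.* n ℕ.< 25 ℕ.* k → 2 ℕ.* k ℕ.< n → IntegralHalf G
    twoPathHalf v 2≤k 4n<25k 2k<n =
      let u , w , u≢w , v~u , v~w = two-members (adj G v) (subst (2 ℕ.≤_) (sym (regular v)) 2≤k)
          open TwoPath u v w v~u v~w u≢w
          feasible = order-ℕ v , 4n<25k , 2k<n , krein
          c≤15 , k<80 = feasible-bounds 2≤k 0<c feasible
          W , admissible = Any.satisfied (feasible⇒admissible 0<c c≤15 k<80 feasible)
      in admissible⇒integralHalf W admissible
      where
      -- For c = 0 the order equation reads k = k², which fails for k ≥ 2.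
      0<c : 0 ℕ.< c
      0<c = ℕ.n≢0⇒n>0 λ c≡0 → ℕ.<⇒≢
        (ℕ.<-≤-trans (ℕ.m<m*n k k {{ℕ.>-nonZero (ℕ.<-trans (s≤s z≤n) 2≤k)}} 2≤k) (ℕ.≤-trans (ℕ.m≤m+n (k ℕ.* k) 0) (ℕ.m≤m+n _ 0)))
        (subst (λ c → c ℕ.* n ℕ.+ k ≡ k ℕ.* k ℕ.+ c ℕ.+ c ℕ.* k) c≡0 (order-ℕ v))

    integralHalf : .{{NonZero n}} → IntegralHalf G
    integralHalf with 25 ℕ.* k ℕ.≤? 4 ℕ.* n
    ... | yes 25k≤4n = uniformHalf 25k≤4n
    ... | no 25k≰4n = dense (Fin.fromℕ< (ℕ.>-nonZero⁻¹ n)) k refl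
      where
      -- The degree `k` is a module parameter, so the case split runs over an equal number `m`.
      dense : Fin n → ∀ m → k ≡ m → IntegralHalf G
      dense v ℕ.zero k≡0 = contradiction (subst (λ k → 25 ℕ.* k ℕ.≤ 4 ℕ.* n) (sym k≡0) z≤n) 25k≰4n
      dense v (ℕ.suc m) k≡1+m with n ℕ.≤? 2 ℕ.* k
      ... | yes n≤2k = neighbourhoodHalf {{subst NonZero (sym k≡1+m) _}} n≤2k v
      dense v 1 k≡1 | no n≰2k =
        let u , v~u = member (adj G v) (ℕ.≤-reflexive (trans (sym k≡1) (sym (regular v))))
        in matchingHalf v u v~u k≡1 (subst (λ k → 4 ℕ.* n ℕ.< 25 ℕ.* k) k≡1 (ℕ.≰⇒> 25k≰4n))
      dense v (ℕ.suc (ℕ.suc m)) k≡2+m | no n≰2k =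
        twoPathHalf v (subst (2 ℕ.≤_) (sym k≡2+m) (s≤s (s≤s z≤n))) (ℕ.≰⇒> 25k≰4n) (ℕ.≰⇒> n≰2k)

open import Defs
open import Data.Nat using (ℕ; NonZero)
open import Data.Integer using (+_)
open import Data.Product using (_×_; _,_; ∃-syntax)
open import Data.Rational using (_/_)

theorem3p5 : ∀ {n : ℕ} .{{_ : NonZero n}} (G : Graph n) →
    TriangleFreeStronglyRegular G →
    ∃[ b ] (b Isβ G × b ≤ fromℚ (+ 1 / 50))
theorem3p5 G ((k , regular) , triangleFree , (c , common)) =
  IntegralHalves.integralHalf⇒β≤1/50 G
    (SparseHalves.integralHalf G triangleFree k regular c common)
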